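{- For every fixed prime power $q$ and every integer $n \ge 2$, $$\chi_q(n) < \frac{2n}{q-1} + q.$$ Moreover, when $n \le \binom{q/2}{2} = \frac{(q/2)(q/2-1)}{2}$, we also have $$\chi_q(n) \le \sqrt{8n} + 4.$$
   Context: $\mathrm{PG}(n-1,q)$ denotes the $(n-1)$-dimensional projective space over the finite field $\mathbb{F}_q$, i.e. the points are the $1$-dimensional subspaces of $\mathbb{F}_q^n$ and the lines are the $2$-dimensional subspaces. The chromatic number $\chi_q(n)$ of $\mathrm{PG}(n-1,q)$ is the smallest number of colors needed to color the points of $\mathrm{PG}(n-1,q)$ so that no line has all of its points in a single color class. -}

module Defs where

open import Level using (0ℓ)
open import Data.Nat using (ℕ)
open import Data.Fin using (Fin)
open import Data.Product using (Σ; _×_)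
open import Relation.Nullary using (¬_)
open import Relation.Binary.PropositionalEquality using (_≡_)
import Relation.Binary.PropositionalEquality as ≡
open import Algebra.Bundles using (CommutativeRing)
open import Function.Bundles using (Inverse)

-- A finite field with exactly q elements (q is then necessarily a prime
-- power, and every field of order q is isomorphic to 𝔽_q).
record FiniteField (q : ℕ) : Set₁ where
  field
    commRing : CommutativeRing 0ℓ 0ℓ
  open CommutativeRing commRing public
  field
    0≉1     : ¬ (0# ≈ 1#)
    inverse : ∀ x → ¬ (x ≈ 0#) → Σ Carrier (λ y → x * y ≈ 1#)
    enum    : Inverse (≡.setoid (Fin q)) setoid

module _ {q : ℕ} (F : FiniteField q) where
  open FiniteField F

  Vect : ℕ → Set
  Vect n = Fin n → Carrier

  IsZero : ∀ {n} → Vect n → Set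
  IsZero v = ∀ i → v i ≈ 0#

  _≈ᵥ_ : ∀ {n} → Vect n → Vect n → Set
  u ≈ᵥ v = ∀ i → u i ≈ v i

  scale : ∀ {n} → Carrier → Vect n → Vect n
  scale a v i = a * v i

  lin : ∀ {n} → Carrier → Vect n → Carrier → Vect n → Vect n
  lin a u b v i = a * u i + b * v i

  LinIndep : ∀ {n} → Vect n → Vect n → Set
  LinIndep u v = ∀ a b → IsZero (lin a u b v) → (a ≈ 0#) × (b ≈ 0#)

  -- A coloring of the points of PG(n-1,q) with k colors, represented as a
  -- map on vectors that is well defined on points (1-dim subspaces),
  -- such that no line (2-dim subspace span{u,v}) is monochromatic.
  -- Its value on the zero vector is irrelevant.
  record ProperColoring (n k : ℕ) (c : Vect n → Fin k) : Set where
    field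
      respects-≈   : ∀ u v → u ≈ᵥ v → c u ≡ c v
      respects-pts : ∀ a v → ¬ (a ≈ 0#) → ¬ IsZero v → c (scale a v) ≡ c v
      no-mono-line : ∀ u v → LinIndep u v →
                     ¬ (∀ a b → ¬ IsZero (lin a u b v) → c (lin a u b v) ≡ c u)

  -- PG(n-1,q) admits a proper coloring with k colors (i.e. χ_q(n) ≤ k)
  Colorable : ℕ → ℕ → Set
  Colorable n k = Σ (Vect n → Fin k) (ProperColoring n k)

{- Points are coloured through a polynomial f on an affine space over F whose restriction to every
affine line is nonconstant of degree at most D < q.  Such a line takes each value of f at most D
times, so f distinguishes points of the line even after its q values are merged into k classes,
provided the classes have fewer than q / D elements.  Normalising the first nonzero coordinate
turns this into a colouring of projective space, and the bounds follow by adding colourings of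
blocks of coordinates; the first uses D = q - 1 and k = q, the second k = 2 D.

For f take the sum of anisotropic forms of degrees d = 1, …, D, the d-th one in d variables of its
own; this uses D (D + 1) / 2 variables.  The form of degree d is the norm y^(1 + q + … + q^(d-1))
on the span of 1, ξ, …, ξ^(d-1), where ξ lies in an integral domain K over F with ξ^(q^d) = ξ but
ξ^(q^m) ≠ ξ for 0 < m < d.

To find K, consider A = F[X]/(X^(q^d - 1) - 1).  All its elements satisfy x^(q^d) = x, so it is
reduced, and T = ∏_{0 < m < d} (X^(q^m) - X) is nonzero in it because deg T < q^d - 1.  If the
annihilator of a nonzero multiple z of T is maximal among such annihilators, then it is prime, so
K = A / AnnihilatorQuotients z is a domain, and T is nonzero in K since T z ≠ 0. -}
module Submission where

open import Defs
open import Level using (0ℓ)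
open import Algebra.Bundles using (CommutativeRing)
open import Algebra.Morphism.Structures using (module RingMorphisms)
open RingMorphisms using (IsRingHomomorphism)
import Algebra.Properties.CommutativeMonoid.Sum as MonoidSum
import Algebra.Properties.CommutativeSemiring.Exp as Exp
import Algebra.Properties.Ring as RingProperties
import Algebra.Solver.Ring.NaturalCoefficients.Default as Solver
open import Data.Fin using (Fin; zero; suc; toℕ; fromℕ; fromℕ<; inject₁; inject≤; finToFun; funToFin; _↑ˡ_; _↑ʳ_; splitAt)
open import Data.Fin.Permutation using (Permutation′; permutation)
import Data.Fin.Properties as Fin
open import Data.Nat as ℕ using (ℕ; zero; suc)
open import Data.Nat.DivMod using (_/_; _%_; _mod_; m%n<n; m≡m%n+[m/n]*n; /-monoˡ-≤)
import Data.Nat.Properties as ℕ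
open import Data.Product using (Σ; _×_; _,_; proj₁; proj₂)
open import Data.Sum as Sum using (_⊎_; inj₁; inj₂)
open import Function using (_∘_)
open import Function.Bundles using (Inverse)
import Relation.Binary.Reasoning.Setoid as SetoidReasoning
open import Relation.Binary.Definitions using (tri<; tri≈; tri>)
open import Relation.Binary.PropositionalEquality as ≡ using (_≡_; _≢_)
open import Relation.Nullary using (¬_; Dec; yes; no; contradiction; ¬?)
open import Relation.Nullary.Decidable using (_×-dec_; decidable-stable; map′)
open import Relation.Unary using (Decidable)

-- Polynomials over a commutative ring: division, root counting, leading coefficients.

module Polynomials (A : CommutativeRing 0ℓ 0ℓ) where
  open CommutativeRing A hiding (zero)
  open RingProperties ring
  open Exp commutativeSemiring using (_^_)
  open Solver commutativeSemiring using (solve; _:=_; _:+_; _:*_; con)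
  open SetoidReasoning setoid

  -- Not being a zero divisor replaces being nonzero, because roots are also counted over rings that
  -- are not domains; there the differences of distinct scalars are still units.
  Regular : Carrier → Set
  Regular x = ∀ a → x * a ≈ 0# → a ≈ 0#

  eval : ∀ {n} → (Fin n → Carrier) → Carrier → Carrier
  eval {zero}  p t = 0#
  eval {suc n} p t = p zero + t * eval (p ∘ suc) t

  eval-cong : ∀ {n} (p q : Fin n → Carrier) {s t} → (∀ i → p i ≈ q i) → s ≈ t → eval p s ≈ eval q t
  eval-cong {zero}  p q _   _   = refl
  eval-cong {suc n} p q p≈q s≈t = +-cong (p≈q zero) (*-cong s≈t (eval-cong (p ∘ suc) (q ∘ suc) (p≈q ∘ suc) s≈t))

  eval-0 : ∀ {n} {p : Fin n → Carrier} t → (∀ i → p i ≈ 0#) → eval p t ≈ 0#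
  eval-0 {zero}  t p≈0 = refl
  eval-0 {suc n} t p≈0 = trans (+-cong (p≈0 zero) (trans (*-congˡ (eval-0 t (p≈0 ∘ suc))) (zeroʳ t))) (+-identityˡ 0#)

  eval-+ : ∀ {n} (p q : Fin n → Carrier) t → eval (λ i → p i + q i) t ≈ eval p t + eval q t
  eval-+ {zero}  p q t = sym (+-identityˡ 0#)
  eval-+ {suc n} p q t = trans (+-congˡ (*-congˡ (eval-+ (p ∘ suc) (q ∘ suc) t)))
    (solve 5 (λ a b t x y → (a :+ b) :+ t :* (x :+ y) := (a :+ t :* x) :+ (b :+ t :* y)) refl _ _ _ _ _)

  eval-* : ∀ {n} a (p : Fin n → Carrier) t → eval (λ i → a * p i) t ≈ a * eval p t
  eval-* {zero}  a p t = sym (zeroʳ a)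
  eval-* {suc n} a p t = trans (+-congˡ (*-congˡ (eval-* a (p ∘ suc) t)))
    (solve 4 (λ a b t x → a :* b :+ t :* (a :* x) := a :* (b :+ t :* x)) refl _ _ _ _)

  eval-neg : ∀ {n} (p : Fin n → Carrier) t → eval (λ i → - p i) t ≈ - eval p t
  eval-neg p t = trans (eval-cong (λ i → - p i) _ (λ i → sym (-1*x≈-x (p i))) refl) (trans (eval-* (- 1#) p t) (-1*x≈-x _))

  eval-sub : ∀ {n} (p q : Fin n → Carrier) t → eval (λ i → p i - q i) t ≈ eval p t - eval q t
  eval-sub p q t = trans (eval-+ p _ t) (+-congˡ (eval-neg q t))

  snoc : ∀ {n} → (Fin n → Carrier) → Carrier → Fin (suc n) → Carrier
  snoc {zero}  p a _       = a
  snoc {suc n} p a zero    = p zero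
  snoc {suc n} p a (suc i) = snoc (p ∘ suc) a i

  snoc-last : ∀ {n} (p : Fin n → Carrier) a → snoc p a (fromℕ n) ≡ a
  snoc-last {zero}  p a = ≡.refl
  snoc-last {suc n} p a = snoc-last (p ∘ suc) a

  snoc-inject₁ : ∀ {n} (p : Fin n → Carrier) a i → snoc p a (inject₁ i) ≡ p i
  snoc-inject₁ {suc n} p a zero    = ≡.refl
  snoc-inject₁ {suc n} p a (suc i) = snoc-inject₁ (p ∘ suc) a i

  eval-snoc : ∀ {n} (p : Fin n → Carrier) a t → eval (snoc p a) t ≈ eval p t + a * t ^ n
  eval-snoc {zero}  p a t = solve 2 (λ a t → a :+ t :* con 0 := con 0 :+ a :* con 1) refl a t
  eval-snoc {suc n} p a t = trans (+-congˡ (*-congˡ (eval-snoc (p ∘ suc) a t)))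
    (solve 5 (λ b t x a y → b :+ t :* (x :+ a :* y) := (b :+ t :* x) :+ a :* (t :* y)) refl _ _ _ _ _)

  -- Synthetic division of p by t − a.
  quotient : ∀ {n} → (Fin (suc n) → Carrier) → Carrier → Fin n → Carrier
  quotient {suc n} p a zero    = eval (p ∘ suc) a
  quotient {suc n} p a (suc i) = quotient (p ∘ suc) a i

  -- The division identity p(t) - p(a) = (t - a) Q(t), rearranged without subtraction into a
  -- semiring identity.
  eval-quotient : ∀ {n} (p : Fin (suc n) → Carrier) a t →
                  eval p t + a * eval (quotient p a) t ≈ eval p a + t * eval (quotient p a) t
  eval-quotient {zero}  p a t =
    solve 3 (λ b a t → (b :+ t :* con 0) :+ a :* con 0 := (b :+ a :* con 0) :+ t :* con 0) refl _ a t
  eval-quotient {suc n} p a t = begin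
    (b + t * P t) + a * (P a + t * Q)
      ≈⟨ solve 6 (λ b t x a y z → (b :+ t :* x) :+ a :* (y :+ t :* z)
                               := (b :+ a :* y) :+ t :* (x :+ a :* z)) refl b t (P t) a (P a) Q ⟩
    (b + a * P a) + t * (P t + a * Q)
      ≈⟨ +-congˡ (*-congˡ (eval-quotient (p ∘ suc) a t)) ⟩
    (b + a * P a) + t * (P a + t * Q) ∎
    where
    b = p zero
    P = eval (p ∘ suc)
    Q = eval (quotient (p ∘ suc) a) t

  -- Each coefficient of the quotient is a tail of `p` evaluated at `a`. Read from the top down, it
  -- reduces to a single coefficient of `p`, as the higher ones are already known to vanish.
  quotient≈0⇒tail≈0 : ∀ {n} (p : Fin (suc n) → Carrier) a →
                      (∀ i → quotient p a i ≈ 0#) → ∀ i → p (suc i) ≈ 0#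
  quotient≈0⇒tail≈0 {suc n} p a q≈0 (suc i) = quotient≈0⇒tail≈0 (p ∘ suc) a (q≈0 ∘ suc) i
  quotient≈0⇒tail≈0 {suc n} p a q≈0 zero    = begin
    p (suc zero)                        ≈⟨ +-identityʳ _ ⟨
    p (suc zero) + 0#                   ≈⟨ +-congˡ (zeroʳ a) ⟨
    p (suc zero) + a * 0#               ≈⟨ +-congˡ (*-congˡ (eval-0 a (quotient≈0⇒tail≈0 (p ∘ suc) a (q≈0 ∘ suc)))) ⟨
    eval (p ∘ suc) a                    ≈⟨ q≈0 zero ⟩
    0#                                  ∎

  vanishing⇒≈0 : ∀ {n} (p x : Fin n → Carrier) → (∀ i j → i ≢ j → Regular (x i - x j)) →
                 (∀ i → eval p (x i) ≈ 0#) → ∀ i → p i ≈ 0#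
  vanishing⇒≈0 {suc n} p x reg roots = λ { zero → head≈0 ; (suc i) → tail≈0 i }
    where
    a = x zero
    Q = quotient p a

    tail≈0 : ∀ i → p (suc i) ≈ 0#
    tail≈0 = quotient≈0⇒tail≈0 p a
      (vanishing⇒≈0 Q (x ∘ suc) (λ i j i≢j → reg (suc i) (suc j) (i≢j ∘ Fin.suc-injective)) λ i →
        let t = x (suc i) in
        reg (suc i) zero (λ ()) (eval Q t) (begin
          (t - a) * eval Q t            ≈⟨ [y-z]x≈yx-zx (eval Q t) t a ⟩
          t * eval Q t - a * eval Q t   ≈⟨ x≈y⇒x∙y⁻¹≈ε (begin
            t * eval Q t                ≈⟨ +-identityˡ _ ⟨
            0# + t * eval Q t           ≈⟨ +-congʳ (roots zero) ⟨
            eval p a + t * eval Q t     ≈⟨ eval-quotient p a t ⟨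
            eval p t + a * eval Q t     ≈⟨ +-congʳ (roots (suc i)) ⟩
            0# + a * eval Q t           ≈⟨ +-identityˡ _ ⟩
            a * eval Q t                ∎) ⟩
          0#                            ∎))

    head≈0 : p zero ≈ 0#
    head≈0 = begin
      p zero                     ≈⟨ +-identityʳ _ ⟨
      p zero + 0#                ≈⟨ +-congˡ (zeroʳ a) ⟨
      p zero + a * 0#            ≈⟨ +-congˡ (*-congˡ (eval-0 a tail≈0)) ⟨
      eval p a                   ≈⟨ roots zero ⟩
      0#                         ∎

  subConst : ∀ {n} → (Fin (suc n) → Carrier) → Carrier → Fin (suc n) → Carrier
  subConst p c zero    = p zero - c
  subConst p c (suc i) = p (suc i)

  eval-subConst : ∀ {n} (p : Fin (suc n) → Carrier) c t → eval (subConst p c) t ≈ eval p t - c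
  eval-subConst p c t = solve 3 (λ x y z → (x :+ y) :+ z := (x :+ z) :+ y) refl _ _ _

  -- The coefficient in degree `n`, which may be zero, is set apart from the lower ones. Products of
  -- linear factors can then be followed without a multiplication of coefficient vectors.
  HasLead : ∀ n → Carrier → (Carrier → Carrier) → Set
  HasLead n a g = Σ (Fin n → Carrier) λ p → ∀ t → g t ≈ eval p t + a * t ^ n

  hasLead-1 : HasLead 0 1# (λ _ → 1#)
  hasLead-1 = (λ ()) , λ t → solve 0 (con 1 := con 0 :+ con 1 :* con 1) refl

  hasLead-* : ∀ {n a g} b c → HasLead n a g → HasLead (suc n) (c * a) (λ t → (b + t * c) * g t)
  hasLead-* {n} {a} {g} b c (p , g≈p) = p′ , λ t → begin
    (b + t * c) * g t
      ≈⟨ *-congˡ (g≈p t) ⟩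
    (b + t * c) * (eval p t + a * t ^ n)
      ≈⟨ solve 6 (λ b t c x a y → (b :+ t :* c) :* (x :+ a :* y)
           := ((b :* x :+ b :* a :* y) :+ (con 0 :+ t :* (c :* x))) :+ (c :* a) :* (t :* y)) refl b t c _ a _ ⟩
    ((b * eval p t + b * a * t ^ n) + (0# + t * (c * eval p t))) + (c * a) * (t * t ^ n)
      ≈⟨ +-congʳ (+-cong (+-congʳ (eval-* b p t)) (+-congˡ (*-congˡ (eval-* c p t)))) ⟨
    ((eval (λ i → b * p i) t + b * a * t ^ n) + eval shifted t) + (c * a) * (t * t ^ n)
      ≈⟨ +-congʳ (+-congʳ (eval-snoc (λ i → b * p i) (b * a) t)) ⟨
    (eval (snoc (λ i → b * p i) (b * a)) t + eval shifted t) + (c * a) * (t * t ^ n)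
      ≈⟨ +-congʳ (eval-+ (snoc (λ i → b * p i) (b * a)) shifted t) ⟨
    eval p′ t + (c * a) * (t * t ^ n) ∎
    where
    shifted : Fin (suc n) → Carrier
    shifted zero    = 0#
    shifted (suc i) = c * p i
    p′ : Fin (suc n) → Carrier
    p′ i = snoc (λ i → b * p i) (b * a) i + shifted i

  hasLead-cong : ∀ {n a b g h} → a ≈ b → (∀ t → h t ≈ g t) → HasLead n a g → HasLead n b h
  hasLead-cong a≈b h≈g (p , g≈p) = p , λ t → trans (h≈g t) (trans (g≈p t) (+-congˡ (*-congʳ a≈b)))

  hasLead-^ : ∀ n x → HasLead n 1# (λ t → (x + t) ^ n)
  hasLead-^ zero    x = hasLead-1
  hasLead-^ (suc n) x = hasLead-cong {g = λ t → (x + t * 1#) * (x + t) ^ n} (*-identityˡ 1#)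
    (λ t → *-congʳ (+-congˡ (sym (*-identityʳ t)))) (hasLead-* x 1# (hasLead-^ n x))

  -- The difference g(t) - t^n - c has degree below `n` and `n` roots with regular differences, so
  -- it vanishes identically. Positivity of `n` makes room for `c` among the lower coefficients.
  monic-determined : ∀ {n g} c (x : Fin n → Carrier) → 0 ℕ.< n →
                     (∀ i j → i ≢ j → Regular (x i - x j)) → HasLead n 1# g →
                     (∀ i → g (x i) ≈ c + x i ^ n) → ∀ t → g t ≈ c + t ^ n
  monic-determined {suc n} {g} c x _ reg (p , g≈p) agree t = begin
    g t                              ≈⟨ g≈p t ⟩
    eval p t + 1# * t ^ suc n        ≈⟨ +-cong eval≈c (*-identityˡ _) ⟩
    c + t ^ suc n                    ∎
    where
    p-c≈0 : ∀ i → subConst p c i ≈ 0#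
    p-c≈0 = vanishing⇒≈0 (subConst p c) x reg λ i → trans (eval-subConst p c (x i))
      (x≈y⇒x∙y⁻¹≈ε (+-cancelʳ (x i ^ suc n) _ _ (begin
        eval p (x i) + x i ^ suc n        ≈⟨ +-congˡ (*-identityˡ _) ⟨
        eval p (x i) + 1# * x i ^ suc n   ≈⟨ g≈p (x i) ⟨
        g (x i)                           ≈⟨ agree i ⟩
        c + x i ^ suc n                   ∎)))

    eval≈c : eval p t ≈ c
    eval≈c = x∙y⁻¹≈ε⇒x≈y _ _ (trans (sym (eval-subConst p c t)) (eval-0 t p-c≈0))

-- Arithmetic of a finite field and the identity x^q = x.

module FieldElements {q : ℕ} (F : FiniteField q) where
  open FiniteField F hiding (zero)
  open Exp commutativeSemiring using (_^_)
  open Solver commutativeSemiring using (solve; _:=_; _:*_)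
  open SetoidReasoning setoid
  open MonoidSum *-commutativeMonoid using () renaming
    (sum to ∏; sum-cong-≋ to ∏-cong; ∑-distrib-+ to ∏-distrib-*; sum-permute to ∏-permute; sum-replicate to ∏-replicate)

  el : Fin q → Carrier
  el = Inverse.to enum

  idx : Carrier → Fin q
  idx = Inverse.from enum

  el-idx : ∀ x → el (idx x) ≈ x
  el-idx = Inverse.strictlyInverseˡ enum

  idx-el : ∀ i → idx (el i) ≡ i
  idx-el = Inverse.strictlyInverseʳ enum

  idx-cong : ∀ {x y} → x ≈ y → idx x ≡ idx y
  idx-cong = Inverse.from-cong enum

  idx-injective : ∀ {x y} → idx x ≡ idx y → x ≈ y
  idx-injective {x} {y} eq = trans (sym (el-idx x)) (trans (Inverse.to-cong enum eq) (el-idx y))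

  el-injective : ∀ {i j} → el i ≈ el j → i ≡ j
  el-injective {i} {j} eq = ≡.trans (≡.sym (idx-el i)) (≡.trans (idx-cong eq) (idx-el j))

  _≟_ : ∀ x y → Dec (x ≈ y)
  x ≟ y = map′ idx-injective idx-cong (idx x Fin.≟ idx y)

  *-cancelˡ-nonZero : ∀ {x y z} → ¬ x ≈ 0# → x * y ≈ x * z → y ≈ z
  *-cancelˡ-nonZero {x} {y} {z} x≉0 eq with inverse x x≉0
  ... | x⁻¹ , xx⁻¹≈1 = trans (sym (absorb y)) (trans (*-congˡ eq) (absorb z))
    where
    absorb : ∀ w → x⁻¹ * (x * w) ≈ w
    absorb w = begin
      x⁻¹ * (x * w) ≈⟨ solve 3 (λ u x w → u :* (x :* w) := (x :* u) :* w) refl x⁻¹ x w ⟩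
      (x * x⁻¹) * w ≈⟨ *-congʳ xx⁻¹≈1 ⟩
      1# * w        ≈⟨ *-identityˡ w ⟩
      w             ∎

  *-nonZero : ∀ {x y} → ¬ x ≈ 0# → ¬ y ≈ 0# → ¬ x * y ≈ 0#
  *-nonZero x≉0 y≉0 xy≈0 = y≉0 (*-cancelˡ-nonZero x≉0 (trans xy≈0 (sym (zeroʳ _))))

  ∏-nonZero : ∀ {n} (f : Fin n → Carrier) → (∀ i → ¬ f i ≈ 0#) → ¬ ∏ f ≈ 0#
  ∏-nonZero {zero}  f f≉0 = 0≉1 ∘ sym
  ∏-nonZero {suc n} f f≉0 = *-nonZero (f≉0 zero) (∏-nonZero (f ∘ suc) (f≉0 ∘ suc))

  ∏-one : ∀ {n} (f : Fin n → Carrier) → (∀ i → f i ≈ 1#) → ∏ f ≈ 1#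
  ∏-one {zero}  f f≈1 = refl
  ∏-one {suc n} f f≈1 = trans (*-cong (f≈1 zero) (∏-one (f ∘ suc) (f≈1 ∘ suc))) (*-identityˡ 1#)

  ∏-single : ∀ {n} (j : Fin n) (f : Fin n → Carrier) → (∀ i → i ≢ j → f i ≈ 1#) → ∏ f ≈ f j
  ∏-single zero    f f≈1 = trans (*-congˡ (∏-one (f ∘ suc) (λ i → f≈1 (suc i) λ ()))) (*-identityʳ _)
  ∏-single (suc j) f f≈1 = trans (*-cong (f≈1 zero (λ ())) (∏-single j (f ∘ suc)
    λ i i≢j → f≈1 (suc i) (i≢j ∘ Fin.suc-injective))) (*-identityˡ _)

  private
    ifZero : Carrier → Carrier → Carrier → Carrier
    ifZero x a b with x ≟ 0#
    ... | yes _ = a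
    ... | no  _ = b

    ifZero-yes : ∀ {x} a b → x ≈ 0# → ifZero x a b ≡ a
    ifZero-yes {x} a b x≈0 with x ≟ 0#
    ... | yes _   = ≡.refl
    ... | no  x≉0 = contradiction x≈0 x≉0

    ifZero-no : ∀ {x} a b → ¬ x ≈ 0# → ifZero x a b ≡ b
    ifZero-no {x} a b x≉0 with x ≟ 0#
    ... | yes x≈0 = contradiction x≈0 x≉0
    ... | no  _   = ≡.refl

  -- Multiplication by a permutes the nonzero elements, so it fixes their product.
  x^q≈x : ∀ a → a ^ q ≈ a
  x^q≈x a with a ≟ 0#
  -- An index in `Fin q` shows that `q` is positive, so that a power of zero is zero.
  ... | yes a≈0 = lemma (idx 0#)
    where
    lemma : ∀ {n} → Fin n → a ^ n ≈ a
    lemma {suc n} _ = trans (*-congʳ a≈0) (trans (zeroˡ _) (sym a≈0))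
  ... | no a≉0 with inverse a a≉0
  ...   | a⁻¹ , aa⁻¹≈1 = begin
    a ^ q                    ≈⟨ ∏-replicate q {a} ⟨
    ∏ {q} (λ i → a)          ≈⟨ ∏-cong s*s′ ⟨
    ∏ (λ i → s i * s′ i)     ≈⟨ ∏-distrib-* s s′ ⟩
    ∏ s * ∏ s′               ≈⟨ *-cong ∏s≈1 ∏s′≈a ⟩
    1# * a                   ≈⟨ *-identityˡ a ⟩
    a                        ∎
    where
    -- To keep all products indexed by `Fin q`, the factor of `a ^ q` at the zero element is moved
    -- to `s′`, the others stay in `s`, and `g` has 1 in place of the zero element.
    s s′ g : Fin q → Carrier
    s  i = ifZero (el i) 1# a
    s′ i = ifZero (el i) a 1#
    g  i = ifZero (el i) 1# (el i)

    s*s′ : ∀ i → s i * s′ i ≈ a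
    s*s′ i with el i ≟ 0#
    ... | yes _ = *-identityˡ a
    ... | no  _ = *-identityʳ a

    scaleBy : Carrier → Fin q → Fin q
    scaleBy b i = idx (b * el i)

    scaleBy-inverse : ∀ b c → b * c ≈ 1# → ∀ i → scaleBy b (scaleBy c i) ≡ i
    scaleBy-inverse b c bc≈1 i = ≡.trans (idx-cong (begin
      b * el (idx (c * el i))  ≈⟨ *-congˡ (el-idx _) ⟩
      b * (c * el i)           ≈⟨ *-assoc b c _ ⟨
      (b * c) * el i           ≈⟨ *-congʳ bc≈1 ⟩
      1# * el i                ≈⟨ *-identityˡ _ ⟩
      el i                     ∎)) (idx-el i)

    π : Permutation′ q
    π = permutation (scaleBy a) (scaleBy a⁻¹)
      (scaleBy-inverse a a⁻¹ aa⁻¹≈1) (scaleBy-inverse a⁻¹ a (trans (*-comm a⁻¹ a) aa⁻¹≈1))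

    s*g : ∀ i → s i * g i ≈ g (scaleBy a i)
    s*g i with el i ≟ 0#
    ... | yes x≈0 = trans (*-identityˡ 1#) (sym (reflexive (ifZero-yes 1# _
            (trans (el-idx _) (trans (*-congˡ x≈0) (zeroʳ a))))))
    ... | no  x≉0 = sym (trans (reflexive (ifZero-no 1# _ (*-nonZero a≉0 x≉0 ∘ trans (sym (el-idx _))))) (el-idx _))

    ∏g≉0 : ¬ ∏ g ≈ 0#
    ∏g≉0 = ∏-nonZero g λ i → g≉0 i
      where
      g≉0 : ∀ i → ¬ g i ≈ 0#
      g≉0 i with el i ≟ 0#
      ... | yes _   = 0≉1 ∘ sym
      ... | no  x≉0 = x≉0

    ∏s≈1 : ∏ s ≈ 1#
    ∏s≈1 = *-cancelˡ-nonZero ∏g≉0 (begin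
      ∏ g * ∏ s              ≈⟨ *-comm _ _ ⟩
      ∏ s * ∏ g              ≈⟨ ∏-distrib-* s g ⟨
      ∏ (λ i → s i * g i)    ≈⟨ ∏-cong s*g ⟩
      ∏ (g ∘ scaleBy a)      ≈⟨ ∏-permute g π ⟨
      ∏ g                    ≈⟨ *-identityʳ _ ⟨
      ∏ g * 1#               ∎)

    ∏s′≈a : ∏ s′ ≈ a
    ∏s′≈a = trans
      (∏-single (idx 0#) s′ λ i i≢ → reflexive (ifZero-no a 1# λ x≈0 →
        i≢ (≡.trans (≡.sym (idx-el i)) (idx-cong x≈0))))
      (reflexive (ifZero-yes a 1# (el-idx 0#)))

  1<q : 1 ℕ.< q
  1<q = go (idx 0#) (idx 1#) (0≉1 ∘ idx-injective)
    where
    go : ∀ {n} (i j : Fin n) → i ≢ j → 1 ℕ.< n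
    go {suc zero}    zero zero i≢j = contradiction ≡.refl i≢j
    go {suc (suc n)} _    _    _   = ℕ.s≤s (ℕ.s≤s ℕ.z≤n)

-- Frobenius powers in commutative algebras over F.

module Frobenius {q : ℕ} (F : FiniteField q) (A : CommutativeRing 0ℓ 0ℓ)
  (ι : FiniteField.Carrier F → CommutativeRing.Carrier A)
  (ι-isHom : IsRingHomomorphism (FiniteField.rawRing F) (CommutativeRing.rawRing A) ι) where
  private
    module F where
      open FiniteField F public
      open FieldElements F public
      open RingProperties (FiniteField.ring F) public using (x∙y⁻¹≈ε⇒x≈y)
      open Exp (FiniteField.commutativeSemiring F) public using (_^_)
  open CommutativeRing A hiding (zero)
  open RingProperties ring
  open Exp commutativeSemiring using (_^_; ^-congˡ; ^-congʳ; ^-assocʳ; ^-distrib-*)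
  open SetoidReasoning setoid
  open Polynomials A
  open IsRingHomomorphism ι-isHom using (⟦⟧-cong; +-homo; *-homo; 1#-homo; 0#-homo; -‿homo)

  scalar : Fin q → Carrier
  scalar = ι ∘ F.el

  ι-sub : ∀ a b → ι (a F.- b) ≈ ι a - ι b
  ι-sub a b = trans (+-homo a (F.- b)) (+-congˡ (-‿homo b))

  ι-^ : ∀ a n → ι (a F.^ n) ≈ ι a ^ n
  ι-^ a zero    = 1#-homo
  ι-^ a (suc n) = trans (*-homo a _) (*-congˡ (ι-^ a n))

  ι-regular : ∀ {a} → ¬ a F.≈ F.0# → Regular (ι a)
  ι-regular {a} a≉0 x ax≈0 with F.inverse a a≉0
  ... | a⁻¹ , aa⁻¹≈1 = begin
    x                    ≈⟨ *-identityˡ x ⟨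
    1# * x               ≈⟨ *-congʳ (trans (sym 1#-homo) (⟦⟧-cong (F.sym (F.trans (F.*-comm a⁻¹ a) aa⁻¹≈1)))) ⟩
    ι (a⁻¹ F.* a) * x    ≈⟨ *-congʳ (*-homo a⁻¹ a) ⟩
    (ι a⁻¹ * ι a) * x    ≈⟨ *-assoc _ _ _ ⟩
    ι a⁻¹ * (ι a * x)    ≈⟨ *-congˡ ax≈0 ⟩
    ι a⁻¹ * 0#           ≈⟨ zeroʳ _ ⟩
    0#                   ∎

  regular-cong : ∀ {x y} → x ≈ y → Regular x → Regular y
  regular-cong x≈y reg a ya≈0 = reg a (trans (*-congʳ x≈y) ya≈0)

  scalar-regular : ∀ i j → i ≢ j → Regular (scalar i - scalar j)
  scalar-regular i j i≢j = regular-cong (ι-sub _ _) (ι-regular (i≢j ∘ F.el-injective ∘ F.x∙y⁻¹≈ε⇒x≈y _ _))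

  ι-fixed : ∀ a → ι a ^ q ≈ ι a
  ι-fixed a = trans (sym (ι-^ a q)) (⟦⟧-cong (F.x^q≈x a))

  -- For fixed x, the polynomial (x + t)^q - t^q in t has degree less than q, so it is constant
  -- once it takes the value x^q at all scalars. First take x itself to be a scalar.
  ^q-+ : ∀ x y → (x + y) ^ q ≈ x ^ q + y ^ q
  ^q-+ x = extend x λ i → begin
    (x + scalar i) ^ q             ≈⟨ ^-congˡ q (+-comm x (scalar i)) ⟩
    (scalar i + x) ^ q             ≈⟨ scalar-^q-+ i x ⟩
    scalar i ^ q + x ^ q           ≈⟨ +-comm _ _ ⟩
    x ^ q + scalar i ^ q           ∎
    where
    extend : ∀ x → (∀ i → (x + scalar i) ^ q ≈ x ^ q + scalar i ^ q) →
             ∀ y → (x + y) ^ q ≈ x ^ q + y ^ q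
    extend x = monic-determined (x ^ q) scalar (ℕ.<-trans (ℕ.s≤s ℕ.z≤n) F.1<q) scalar-regular (hasLead-^ q x)

    scalar-^q-+ : ∀ i y → (scalar i + y) ^ q ≈ scalar i ^ q + y ^ q
    scalar-^q-+ i = extend (scalar i) λ j → begin
      (scalar i + scalar j) ^ q      ≈⟨ ^-congˡ q (+-homo _ _) ⟨
      ι (F.el i F.+ F.el j) ^ q      ≈⟨ ι-fixed _ ⟩
      ι (F.el i F.+ F.el j)          ≈⟨ +-homo _ _ ⟩
      scalar i + scalar j            ≈⟨ +-cong (ι-fixed _) (ι-fixed _) ⟨
      scalar i ^ q + scalar j ^ q    ∎

  frob : ℕ → Carrier → Carrier
  frob i x = x ^ (q ℕ.^ i)

  frob-cong : ∀ i {x y} → x ≈ y → frob i x ≈ frob i y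
  frob-cong i = ^-congˡ (q ℕ.^ i)

  frob-0 : ∀ x → frob 0 x ≈ x
  frob-0 x = *-identityʳ x

  frob-suc : ∀ i x → frob (suc i) x ≈ frob i (x ^ q)
  frob-suc i x = sym (^-assocʳ x q (q ℕ.^ i))

  frob-∘ : ∀ i j x → frob i (frob j x) ≈ frob (i ℕ.+ j) x
  frob-∘ i j x = trans (^-assocʳ x (q ℕ.^ j) (q ℕ.^ i)) (^-congʳ x
    (≡.trans (ℕ.*-comm (q ℕ.^ j) (q ℕ.^ i)) (≡.sym (ℕ.^-distribˡ-+-* q i j))))

  frob-+ : ∀ i x y → frob i (x + y) ≈ frob i x + frob i y
  frob-+ zero    x y = trans (frob-0 _) (sym (+-cong (frob-0 x) (frob-0 y)))
  frob-+ (suc i) x y = begin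
    frob (suc i) (x + y)               ≈⟨ frob-suc i _ ⟩
    frob i ((x + y) ^ q)               ≈⟨ frob-cong i (^q-+ x y) ⟩
    frob i (x ^ q + y ^ q)             ≈⟨ frob-+ i _ _ ⟩
    frob i (x ^ q) + frob i (y ^ q)    ≈⟨ +-cong (frob-suc i x) (frob-suc i y) ⟨
    frob (suc i) x + frob (suc i) y    ∎

  frob-* : ∀ i x y → frob i (x * y) ≈ frob i x * frob i y
  frob-* i x y = ^-distrib-* x y (q ℕ.^ i)

  frob-ι : ∀ i a → frob i (ι a) ≈ ι a
  frob-ι zero    a = frob-0 (ι a)
  frob-ι (suc i) a = trans (frob-suc i _) (trans (frob-cong i (ι-fixed a)) (frob-ι i a))

  frob-0# : ∀ i → frob i 0# ≈ 0#
  frob-0# i = trans (frob-cong i (sym 0#-homo)) (trans (frob-ι i F.0#) 0#-homo)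

  frob-eval : ∀ {n} i (p : Fin n → Carrier) t → frob i (eval p t) ≈ eval (frob i ∘ p) (frob i t)
  frob-eval {zero}  i p t = frob-0# i
  frob-eval {suc n} i p t = trans (frob-+ i _ _)
    (+-congˡ (trans (frob-* i t _) (*-congˡ (frob-eval i (p ∘ suc) t))))

  frob-sub : ∀ i x y → frob i (x - y) ≈ frob i x - frob i y
  frob-sub i x y = trans (frob-+ i x (- y)) (+-congˡ (begin
    frob i (- y)           ≈⟨ frob-cong i (-1*x≈-x y) ⟨
    frob i (- 1# * y)      ≈⟨ frob-* i _ _ ⟩
    -- `- 1#` is the image of a scalar, so `frob` fixes it in every characteristic.
    frob i (- 1#) * frob i y ≈⟨ *-congʳ (trans (frob-cong i (sym -1≈)) (trans (frob-ι i _) -1≈)) ⟩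
    - 1# * frob i y        ≈⟨ -1*x≈-x _ ⟩
    - frob i y             ∎))
    where
    -1≈ : ι (F.- F.1#) ≈ - 1#
    -1≈ = trans (-‿homo F.1#) (-‿cong 1#-homo)

-- Anisotropic forms and norm forms.

module Forms {q : ℕ} (F : FiniteField q) where
  open Polynomials (FiniteField.commRing F) using (eval)
  open FiniteField F

  -- Anisotropy is expressed on lines: the coefficient of degree `d` in direction `w`, which for a
  -- norm form is its value at `w`, vanishes only for zero `w`.
  record AnisotropicForm (d : ℕ) : Set where
    field
      form      : Vect F d → Carrier
      form-cong : ∀ {c c′ : Vect F d} → (∀ i → c i ≈ c′ i) → form c ≈ form c′
      form-line : ∀ (c w : Vect F d) → Σ (Fin (suc d) → Carrier) λ b →
                  (∀ a → form (λ i → c i + a * w i) ≈ eval b a) × (b (fromℕ d) ≈ 0# → IsZero F w)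

module NormForms {q : ℕ} (F : FiniteField q) (A : CommutativeRing 0ℓ 0ℓ)
  (ι : FiniteField.Carrier F → CommutativeRing.Carrier A)
  (ι-isHom : IsRingHomomorphism (FiniteField.rawRing F) (CommutativeRing.rawRing A) ι) where
  private
    module F where
      open FiniteField F public
      open FieldElements F public
      open Polynomials (FiniteField.commRing F) public
      open RingProperties (FiniteField.ring F) public using (x∙y⁻¹≈ε⇒x≈y)
  open CommutativeRing A hiding (zero)
  open RingProperties ring
  open Exp commutativeSemiring using (_^_; ^-congˡ; ^-congʳ; ^-assocʳ; ^-distrib-*)
  open SetoidReasoning setoid
  open Polynomials A
  open Frobenius F A ι ι-isHom
  open IsRingHomomorphism ι-isHom using (⟦⟧-cong; +-homo; *-homo; 0#-homo)

  module _ (_≟_ : ∀ x y → Dec (x ≈ y)) (1≉0 : ¬ 1# ≈ 0#)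
    (integral : ∀ {x y} → x * y ≈ 0# → x ≈ 0# ⊎ y ≈ 0#) where

    ≉⇒regular : ∀ {x y} → ¬ x ≈ y → Regular (x - y)
    ≉⇒regular x≉y a [x-y]a≈0 with integral [x-y]a≈0
    ... | inj₁ x-y≈0 = contradiction (x∙y⁻¹≈ε⇒x≈y _ _ x-y≈0) x≉y
    ... | inj₂ a≈0   = a≈0

    ι-injective : ∀ {a b} → ι a ≈ ι b → a F.≈ b
    ι-injective {a} {b} ιa≈ιb with a F.≟ b
    ... | yes a≈b = a≈b
    ... | no  a≉b = contradiction
      (ι-regular (a≉b ∘ F.x∙y⁻¹≈ε⇒x≈y a b) 1# (trans (*-identityʳ _) (trans (ι-sub a b) (x≈y⇒x∙y⁻¹≈ε ιa≈ιb)))) 1≉0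

    ι-zero : ∀ {a} → ι a ≈ 0# → a F.≈ F.0#
    ι-zero ιa≈0 = ι-injective (trans ιa≈0 (sym 0#-homo))

    -- With `n + 1` roots, t^n - t would have all coefficients zero, including the leading 1;
    -- `1 < n` keeps that one apart from the coefficient of t.
    few-fixed-points : ∀ {n} → 1 ℕ.< n → (x : Fin (suc n) → Carrier) →
                       (∀ i j → i ≢ j → Regular (x i - x j)) → ¬ (∀ i → x i ^ n ≈ x i)
    few-fixed-points {suc (suc r)} (ℕ.s≤s (ℕ.s≤s _)) x reg fixed = 1≉0 (begin
      1#                    ≈⟨ reflexive (snoc-last p 1#) ⟨
      snoc p 1# (fromℕ n)   ≈⟨ vanishing⇒≈0 (snoc p 1#) x reg (λ i → trans (eval-snoc p 1# (x i)) (roots (x i) (fixed i))) (fromℕ n) ⟩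
      0#                    ∎)
      where
      n = suc (suc r)
      p : Fin n → Carrier
      p zero          = 0#
      p (suc zero)    = - 1#
      p (suc (suc i)) = 0#
      roots : ∀ t → t ^ n ≈ t → eval p t + 1# * t ^ n ≈ 0#
      roots t t^n≈t = begin
        eval p t + 1# * t ^ n    ≈⟨ +-cong (+-identityˡ _) (trans (*-identityˡ _) t^n≈t) ⟩
        t * (- 1# + t * eval (λ i → p (suc (suc i))) t) + t
          ≈⟨ +-congʳ (*-congˡ (trans (+-congˡ (trans (*-congˡ (eval-0 {r} {λ i → p (suc (suc i))} t (λ _ → refl))) (zeroʳ t))) (+-identityʳ _))) ⟩
        t * - 1# + t             ≈⟨ +-congʳ (trans (*-comm _ _) (-1*x≈-x t)) ⟩
        - t + t                  ≈⟨ -‿inverseˡ t ⟩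
        0#                       ∎

    -- By `ι-fixed` the `q` scalars are already roots of t^q - t; a root outside them would be one
    -- too many.
    fixed⇒scalar : ∀ y → y ^ q ≈ y → Σ F.Carrier λ a → ι a ≈ y
    fixed⇒scalar y y^q≈y with Fin.any? (λ i → scalar i ≟ y)
    ... | yes (i , eq) = F.el i , eq
    ... | no  ¬scalar  = contradiction
      (λ { zero → y^q≈y ; (suc i) → ι-fixed _ })
      (few-fixed-points F.1<q x λ
        { zero    zero    i≢j → contradiction ≡.refl i≢j
        ; zero    (suc j) _   → ≉⇒regular (λ eq → ¬scalar (j , sym eq))
        ; (suc i) zero    _   → ≉⇒regular (λ eq → ¬scalar (i , eq))
        ; (suc i) (suc j) i≢j → scalar-regular i j (i≢j ∘ ≡.cong suc) })
      where
      x : Fin (suc q) → Carrier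
      x zero    = y
      x (suc i) = scalar i

    ^-zero : ∀ {x} n → x ^ n ≈ 0# → x ≈ 0#
    ^-zero zero    1≈0 = contradiction 1≈0 1≉0
    ^-zero (suc n) eq  with integral eq
    ... | inj₁ x≈0 = x≈0
    ... | inj₂ eq′ = ^-zero n eq′

    -- The power y^(1 + q + ... + q^(n-1)), kept as a product of conjugates because each factor is
    -- linear in the parameter along a line.
    norm : ℕ → Carrier → Carrier
    norm zero    y = 1#
    norm (suc n) y = frob n y * norm n y

    norm-cong : ∀ n {x y} → x ≈ y → norm n x ≈ norm n y
    norm-cong zero    x≈y = refl
    norm-cong (suc n) x≈y = *-cong (frob-cong n x≈y) (norm-cong n x≈y)

    norm-zero : ∀ n {y} → norm n y ≈ 0# → y ≈ 0#
    norm-zero zero    1≈0 = contradiction 1≈0 1≉0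
    norm-zero (suc n) eq with integral eq
    ... | inj₁ eq′ = ^-zero (q ℕ.^ n) eq′
    ... | inj₂ eq′ = norm-zero n eq′

    -- Both sides are the product of the conjugates from `frob 0 y` to `frob n y`; the extra factor
    -- `y` avoids a division.
    norm-^q : ∀ n y → norm n y ^ q * y ≈ frob n y * norm n y
    norm-^q zero    y = trans (*-congʳ (1^n≈1 q)) (trans (*-comm 1# y) (*-congʳ (sym (frob-0 y))))
      where
      1^n≈1 : ∀ n → 1# ^ n ≈ 1#
      1^n≈1 zero    = refl
      1^n≈1 (suc n) = trans (*-identityˡ _) (1^n≈1 n)
    norm-^q (suc n) y = begin
      (frob n y * norm n y) ^ q * y             ≈⟨ *-congʳ (^-distrib-* _ _ q) ⟩
      (frob n y ^ q * norm n y ^ q) * y         ≈⟨ *-assoc _ _ _ ⟩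
      frob n y ^ q * (norm n y ^ q * y)         ≈⟨ *-cong frob-^q (norm-^q n y) ⟩
      frob (suc n) y * (frob n y * norm n y)    ∎
      where
      frob-^q : frob n y ^ q ≈ frob (suc n) y
      frob-^q = trans (^-assocʳ y (q ℕ.^ n) q) (^-congʳ y (ℕ.*-comm (q ℕ.^ n) q))

    *-cancelʳ-nonZero : ∀ {x y z} → ¬ z ≈ 0# → x * z ≈ y * z → x ≈ y
    *-cancelʳ-nonZero {x} {y} {z} z≉0 eq
      with integral (trans ([y-z]x≈yx-zx z x y) (x≈y⇒x∙y⁻¹≈ε eq))
    ... | inj₁ x-y≈0 = x∙y⁻¹≈ε⇒x≈y _ _ x-y≈0
    ... | inj₂ z≈0   = contradiction z≈0 z≉0

    -- The q-th power permutes the conjugates cyclically. Formally, `y` is cancelled from `norm-^q`,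
    -- so `y ≈ 0#` becomes a case of its own.
    norm-fixed : ∀ n {y} → 0 ℕ.< n → frob n y ≈ y → norm n y ^ q ≈ norm n y
    norm-fixed (suc n) {y} _ fix with y ≟ 0#
    ... | no  y≉0 = *-cancelʳ-nonZero y≉0 (trans (norm-^q (suc n) y) (trans (*-congʳ fix) (*-comm y _)))
    ... | yes y≈0 = trans (^-congˡ q N≈0) (trans (0^q≈0 (ℕ.<-trans (ℕ.s≤s ℕ.z≤n) F.1<q)) (sym N≈0))
      where
      N≈0 : norm (suc n) y ≈ 0#
      N≈0 = trans (*-congʳ (trans (frob-cong n y≈0) (frob-0# n))) (zeroˡ _)
      0^q≈0 : ∀ {n} → 0 ℕ.< n → 0# ^ n ≈ 0#
      0^q≈0 {suc n} _ = zeroˡ _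

    -- The norm of y + t v with each conjugate of t replaced by t itself. At scalars nothing
    -- changes, while the degree in t drops to at most `n`.
    normLine : ℕ → Carrier → Carrier → Carrier → Carrier
    normLine zero    y v t = 1#
    normLine (suc n) y v t = (frob n y + t * frob n v) * normLine n y v t

    normLine-hasLead : ∀ n y v → HasLead n (norm n v) (normLine n y v)
    normLine-hasLead zero    y v = hasLead-1
    normLine-hasLead (suc n) y v = hasLead-* (frob n y) (frob n v) (normLine-hasLead n y v)

    norm-line : ∀ n y v a → norm n (y + ι a * v) ≈ normLine n y v (ι a)
    norm-line zero    y v a = refl
    norm-line (suc n) y v a = *-cong
      (trans (frob-+ n _ _) (+-congˡ (trans (frob-* n _ _) (*-congʳ (frob-ι n a)))))
      (norm-line n y v a)

    frob-1 : ∀ x → frob 1 x ≈ x ^ q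
    frob-1 x = trans (frob-suc 0 x) (frob-0 _)

    module _ (d : ℕ) (0<d : 0 ℕ.< d) (d<q : d ℕ.< q) (ξ : Carrier) (ξ-fixed : frob (d) ξ ≈ ξ)
      (ξ-moved : ∀ m → 0 ℕ.< m → m ℕ.< d → ¬ frob m ξ ≈ ξ) where

      private
        -- In a domain `frob i` is injective, so equal conjugates would make ξ a fixed point of
        -- `frob (j ∸ i)`.
        conjugates-distinct : ∀ {i j} → i ℕ.< j → j ℕ.< d → ¬ frob j ξ ≈ frob i ξ
        conjugates-distinct {i} {j} i<j j<d eq = ξ-moved (j ℕ.∸ i) (ℕ.m<n⇒0<n∸m i<j)
          (ℕ.≤-<-trans (ℕ.m∸n≤m j i) j<d) (x∙y⁻¹≈ε⇒x≈y _ _ (^-zero (q ℕ.^ i) (begin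
            frob i (frob (j ℕ.∸ i) ξ - ξ)             ≈⟨ frob-sub i _ _ ⟩
            frob i (frob (j ℕ.∸ i) ξ) - frob i ξ      ≈⟨ x≈y⇒x∙y⁻¹≈ε (trans (frob-∘ i (j ℕ.∸ i) ξ)
              (trans (reflexive (≡.cong (λ n → frob n ξ) (ℕ.m+[n∸m]≡n (ℕ.<⇒≤ i<j)))) eq)) ⟩
            0#                                        ∎)))

        conjugate : Fin d → Carrier
        conjugate i = frob (toℕ i) ξ

        conjugate-regular : ∀ i j → i ≢ j → Regular (conjugate i - conjugate j)
        conjugate-regular i j i≢j = ≉⇒regular λ eq → lemma eq
          where
          lemma : ¬ conjugate i ≈ conjugate j
          lemma eq with ℕ.<-cmp (toℕ i) (toℕ j)
          ... | tri< i<j _ _ = conjugates-distinct i<j (Fin.toℕ<n j) (sym eq)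
          ... | tri≈ _ i≡j _ = i≢j (Fin.toℕ-injective i≡j)
          ... | tri> _ _ j<i = conjugates-distinct j<i (Fin.toℕ<n i) eq

        element : Vect F d → Carrier
        element c = eval (ι ∘ c) ξ

        element-line : ∀ c a w → element (λ i → c i F.+ a F.* w i) ≈ element c + ι a * element w
        element-line c a w = begin
          eval (λ i → ι (c i F.+ a F.* w i)) ξ       ≈⟨ eval-cong (λ i → ι (c i F.+ a F.* w i)) _ (λ i → trans (+-homo _ _) (+-congˡ (*-homo _ _))) refl ⟩
          eval (λ i → ι (c i) + ι a * ι (w i)) ξ     ≈⟨ eval-+ (ι ∘ c) (λ i → ι a * ι (w i)) ξ ⟩
          element c + eval (λ i → ι a * ι (w i)) ξ   ≈⟨ +-congˡ (eval-* (ι a) (ι ∘ w) ξ) ⟩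
          element c + ι a * element w                ∎

        frob-element : ∀ i c → frob i (element c) ≈ eval (ι ∘ c) (frob i ξ)
        frob-element i c = trans (frob-eval i (ι ∘ c) ξ) (eval-cong _ (ι ∘ c) (λ j → frob-ι i (c j)) refl)

        element-fixed : ∀ c → frob d (element c) ≈ element c
        element-fixed c = trans (frob-element d c) (eval-cong (ι ∘ c) (ι ∘ c) (λ _ → refl) ξ-fixed)

        -- Linear independence of 1, ξ, ..., ξ^(d-1): a polynomial with scalar coefficients that
        -- vanishes at ξ also vanishes at its `d` distinct conjugates, and its degree is below `d`.
        element-zero : ∀ c → element c ≈ 0# → IsZero F c
        element-zero c e≈0 i = ι-zero (vanishing⇒≈0 (ι ∘ c) conjugate conjugate-regular (λ j → begin
          eval (ι ∘ c) (conjugate j)      ≈⟨ frob-element (toℕ j) c ⟨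
          frob (toℕ j) (element c)        ≈⟨ frob-cong (toℕ j) e≈0 ⟩
          frob (toℕ j) 0#                 ≈⟨ frob-0# (toℕ j) ⟩
          0#                              ∎) i)

        normScalar : ∀ c → Σ F.Carrier λ a → ι a ≈ norm d (element c)
        normScalar c = fixed⇒scalar _ (norm-fixed d {element c} 0<d (element-fixed c))

        form : Vect F d → F.Carrier
        form c = proj₁ (normScalar c)

        form-norm : ∀ c → ι (form c) ≈ norm d (element c)
        form-norm c = proj₂ (normScalar c)

        -- A polynomial of degree less than q with scalar values at scalars equals its
        -- Frobenius conjugate there, so its coefficients are scalars.
        coefficients-scalar : (p : Fin (suc d) → Carrier) (f : F.Carrier → F.Carrier) →
                              (∀ a → eval p (ι a) ≈ ι (f a)) → ∀ i → p i ^ q ≈ p i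
        coefficients-scalar p f p≈f i = x∙y⁻¹≈ε⇒x≈y _ _ (vanishing⇒≈0 (λ i → p i ^ q - p i) x
          (λ i j i≢j → scalar-regular _ _ (i≢j ∘ Fin.inject≤-injective d<q d<q i j))
          (λ i → begin
            eval (λ i → p i ^ q - p i) (x i)                 ≈⟨ eval-sub (λ i → p i ^ q) p (x i) ⟩
            eval (λ i → p i ^ q) (x i) - eval p (x i)        ≈⟨ x≈y⇒x∙y⁻¹≈ε (begin
              eval (λ i → p i ^ q) (x i)                     ≈⟨ eval-cong (frob 1 ∘ p) (λ j → p j ^ q) (λ j → frob-1 (p j)) (frob-ι 1 _) ⟨
              eval (frob 1 ∘ p) (frob 1 (x i))               ≈⟨ frob-eval 1 p (x i) ⟨
              frob 1 (eval p (x i))                          ≈⟨ frob-cong 1 (p≈f _) ⟩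
              frob 1 (ι (f _))                               ≈⟨ frob-ι 1 _ ⟩
              ι (f _)                                        ≈⟨ p≈f _ ⟨
              eval p (x i)                                   ∎) ⟩
            0#                                               ∎) i)
          where
          x : Fin (suc d) → Carrier
          -- `d < q` supplies the `d + 1` distinct scalars that a polynomial of degree `d` requires.
          x i = scalar (inject≤ i d<q)

        ι-eval : ∀ {n} (b : Fin n → F.Carrier) a → ι (F.eval b a) ≈ eval (ι ∘ b) (ι a)
        ι-eval {zero}  b a = 0#-homo
        ι-eval {suc n} b a = trans (+-homo _ _) (+-congˡ (trans (*-homo _ _) (*-congˡ (ι-eval (b ∘ suc) a))))

      normForm : Forms.AnisotropicForm F (d)
      normForm = record
        { form      = form
        ; form-cong = λ {c} {c′} c≈c′ → ι-injective (begin
            ι (form c)             ≈⟨ form-norm c ⟩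
            norm d (element c)     ≈⟨ norm-cong d (eval-cong (ι ∘ c) (ι ∘ c′) (λ i → ⟦⟧-cong (c≈c′ i)) refl) ⟩
            norm d (element c′)    ≈⟨ form-norm c′ ⟨
            ι (form c′)            ∎)
        ; form-line = line
        }
        where
        line : ∀ c w → Σ (Fin (suc d) → F.Carrier) λ b →
               (∀ a → form (λ i → c i F.+ a F.* w i) F.≈ F.eval b a) × (b (fromℕ d) F.≈ F.0# → IsZero F w)
        -- The coefficients descend to F by `coefficients-scalar`. The top one is the norm of
        -- `element w`, which is zero only if `element w` and hence `w` is zero.
        line c w = (λ i → proj₁ (coefficient i)) , on-line , λ b≈0 → element-zero w (norm-zero d (begin
          norm d (element w)            ≈⟨ reflexive (snoc-last p _) ⟨
          P (fromℕ d)                   ≈⟨ proj₂ (coefficient (fromℕ d)) ⟨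
          ι (proj₁ (coefficient (fromℕ d))) ≈⟨ ⟦⟧-cong b≈0 ⟩
          ι F.0#                        ≈⟨ 0#-homo ⟩
          0#                            ∎))
          where
          lead : HasLead d (norm d (element w)) (normLine d (element c) (element w))
          lead = normLine-hasLead d (element c) (element w)
          p : Fin d → Carrier
          p = proj₁ lead
          P : Fin (suc d) → Carrier
          P = snoc p (norm d (element w))

          eval-P : ∀ a → eval P (ι a) ≈ ι (form (λ i → c i F.+ a F.* w i))
          eval-P a = begin
            eval P (ι a)                                        ≈⟨ eval-snoc p _ (ι a) ⟩
            eval p (ι a) + norm d (element w) * ι a ^ d         ≈⟨ proj₂ lead (ι a) ⟨
            normLine d (element c) (element w) (ι a)            ≈⟨ norm-line d (element c) (element w) a ⟨
            norm d (element c + ι a * element w)                ≈⟨ norm-cong d (element-line c a w) ⟨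
            norm d (element (λ i → c i F.+ a F.* w i))          ≈⟨ form-norm (λ i → c i F.+ a F.* w i) ⟨
            ι (form (λ i → c i F.+ a F.* w i))                  ∎

          coefficient : ∀ i → Σ F.Carrier λ a → ι a ≈ P i
          coefficient i = fixed⇒scalar (P i) (coefficients-scalar P _ eval-P i)

          on-line : ∀ a → form (λ i → c i F.+ a F.* w i) F.≈ F.eval (λ i → proj₁ (coefficient i)) a
          on-line a = ι-injective (begin
            ι (form (λ i → c i F.+ a F.* w i))                  ≈⟨ eval-P a ⟨
            eval P (ι a)                                        ≈⟨ eval-cong _ P (λ i → proj₂ (coefficient i)) refl ⟨
            eval (λ i → ι (proj₁ (coefficient i))) (ι a)        ≈⟨ ι-eval (λ i → proj₁ (coefficient i)) a ⟨
            ι (F.eval (λ i → proj₁ (coefficient i)) a)          ∎)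

-- Prime annihilators in finite commutative rings.

module PrimeAnnihilators (A : CommutativeRing 0ℓ 0ℓ) where
  open CommutativeRing A hiding (zero)
  open SetoidReasoning setoid
  open Solver commutativeSemiring using (solve; _:=_; _:*_)

  count : ∀ {n} {P : Fin n → Set} → Decidable P → ℕ
  count {zero}  P? = 0
  count {suc n} P? with P? zero
  ... | yes _ = suc (count (P? ∘ suc))
  ... | no  _ = count (P? ∘ suc)

  count≤n : ∀ {n} {P : Fin n → Set} (P? : Decidable P) → count P? ℕ.≤ n
  count≤n {zero}  P? = ℕ.z≤n
  count≤n {suc n} P? with P? zero
  ... | yes _ = ℕ.s≤s (count≤n (P? ∘ suc))
  ... | no  _ = ℕ.m≤n⇒m≤1+n (count≤n (P? ∘ suc))

  count-mono : ∀ {n} {P Q : Fin n → Set} (P? : Decidable P) (Q? : Decidable Q) →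
               (∀ i → P i → Q i) → count P? ℕ.≤ count Q?
  count-mono {zero}  P? Q? P⇒Q = ℕ.z≤n
  count-mono {suc n} P? Q? P⇒Q with P? zero | Q? zero
  ... | yes p | yes _ = ℕ.s≤s (count-mono (P? ∘ suc) (Q? ∘ suc) (P⇒Q ∘ suc))
  ... | yes p | no ¬q = contradiction (P⇒Q zero p) ¬q
  ... | no _  | yes _ = ℕ.m≤n⇒m≤1+n (count-mono (P? ∘ suc) (Q? ∘ suc) (P⇒Q ∘ suc))
  ... | no _  | no _  = count-mono (P? ∘ suc) (Q? ∘ suc) (P⇒Q ∘ suc)

  count-strictMono : ∀ {n} {P Q : Fin n → Set} (P? : Decidable P) (Q? : Decidable Q) →
                     (∀ i → P i → Q i) → ∀ j → ¬ P j → Q j → count P? ℕ.< count Q?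
  count-strictMono P? Q? P⇒Q zero ¬p q with P? zero | Q? zero
  ... | yes p | _     = contradiction p ¬p
  ... | no _  | yes _ = ℕ.s≤s (count-mono (P? ∘ suc) (Q? ∘ suc) (P⇒Q ∘ suc))
  ... | no _  | no ¬q = contradiction q ¬q
  count-strictMono P? Q? P⇒Q (suc j) ¬p q with P? zero | Q? zero
  ... | yes p | yes _ = ℕ.s≤s (count-strictMono (P? ∘ suc) (Q? ∘ suc) (P⇒Q ∘ suc) j ¬p q)
  ... | yes p | no ¬q = contradiction (P⇒Q zero p) ¬q
  ... | no _  | yes _ = ℕ.m<n⇒m<1+n (count-strictMono (P? ∘ suc) (Q? ∘ suc) (P⇒Q ∘ suc) j ¬p q)
  ... | no _  | no _  = count-strictMono (P? ∘ suc) (Q? ∘ suc) (P⇒Q ∘ suc) j ¬p q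

  -- The annihilator is a prime ideal once it is also proper, that is, once `z` is nonzero; this is
  -- tracked separately.
  PrimeAnnihilator : Carrier → Set
  PrimeAnnihilator z = ∀ x y → (x * y) * z ≈ 0# → x * z ≈ 0# ⊎ y * z ≈ 0#

  module _ (_≟_ : ∀ x y → Dec (x ≈ y)) {M : ℕ} (element : Fin M → Carrier)
    (element-surjective : ∀ x → Σ (Fin M) λ i → element i ≈ x) (t : Carrier) where

    private
      annihilates? : ∀ z → Decidable (λ i → element i * z ≈ 0#)
      annihilates? z i = (element i * z) ≟ 0#

      Obstruction : Carrier → Fin M → Fin M → Set
      Obstruction z i j = (¬ element i * z ≈ 0#) × (¬ element j * z ≈ 0#) × ((element i * element j) * z ≈ 0#)

      obstruction? : ∀ z → Dec (Σ (Fin M) λ i → Σ (Fin M) λ j → Obstruction z i j)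
      obstruction? z = Fin.any? λ i → Fin.any? λ j →
        ¬? (annihilates? z i) ×-dec ¬? (annihilates? z j) ×-dec (((element i * element j) * z) ≟ 0#)

      unobstructed⇒prime : ∀ z → ¬ (Σ (Fin M) λ i → Σ (Fin M) λ j → Obstruction z i j) → PrimeAnnihilator z
      unobstructed⇒prime z none x y xyz≈0 with (x * z) ≟ 0# | (y * z) ≟ 0#
      ... | yes xz≈0 | _        = inj₁ xz≈0
      ... | no _     | yes yz≈0 = inj₂ yz≈0
      ... | no xz≉0  | no yz≉0  with element-surjective x | element-surjective y
      ...   | i , ei≈x | j , ej≈y = contradiction
        (i , j , xz≉0 ∘ trans (*-congʳ (sym ei≈x)) , yz≉0 ∘ trans (*-congʳ (sym ej≈y))
               , trans (*-congʳ (*-cong ei≈x ej≈y)) xyz≈0) none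

      -- An obstruction x, y at z makes the annihilator of x z strictly larger than that of z.
      search : ∀ fuel s → ¬ t * s ≈ 0# → M ℕ.< count (annihilates? (t * s)) ℕ.+ fuel →
               Σ Carrier λ s → (¬ t * s ≈ 0#) × PrimeAnnihilator (t * s)
      search zero s _ M<count =
        contradiction (ℕ.<-≤-trans M<count (ℕ.≤-trans (ℕ.≤-reflexive (ℕ.+-identityʳ _)) (count≤n (annihilates? (t * s))))) (ℕ.<-irrefl ≡.refl)
      search (suc fuel) s ts≉0 M<count with obstruction? (t * s)
      ... | no none = s , ts≉0 , unobstructed⇒prime (t * s) none
      ... | yes (i , j , iz≉0 , jz≉0 , ijz≈0) = search fuel (x * s) (iz≉0 ∘ trans (sym move))
        (ℕ.<-≤-trans M<count (ℕ.≤-trans (ℕ.≤-reflexive (ℕ.+-suc _ fuel)) (ℕ.+-monoˡ-≤ fuel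
          (count-strictMono (annihilates? (t * s)) (annihilates? (t * (x * s)))
            (λ k kz≈0 → trans (*-congˡ move) (trans (swap (element k)) (trans (*-congˡ kz≈0) (zeroʳ x))))
            j jz≉0 (trans (*-congˡ move) (trans (sym (*-assoc _ x _)) (trans (*-congʳ (*-comm _ x)) ijz≈0)))))))
        where
        x = element i
        move : t * (x * s) ≈ x * (t * s)
        move = solve 3 (λ t x s → t :* (x :* s) := x :* (t :* s)) refl t x s
        swap : ∀ k → k * (x * (t * s)) ≈ x * (k * (t * s))
        swap k = solve 3 (λ k x z → k :* (x :* z) := x :* (k :* z)) refl k x (t * s)

    -- The search keeps the count of annihilating elements plus the fuel above `M`. No count exceeds
    -- `M`, so the initial fuel `suc M` cannot run out.
    primeAnnihilator : ¬ t ≈ 0# → Σ Carrier λ s → (¬ t * s ≈ 0#) × PrimeAnnihilator (t * s)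
    primeAnnihilator t≉0 = search (suc M) 1# (t≉0 ∘ trans (sym (*-identityʳ t)))
      (ℕ.m≤n+m (suc M) _)

-- The quotient of a ring by the annihilator of an element.

module AnnihilatorQuotients (A : CommutativeRing 0ℓ 0ℓ) (z : CommutativeRing.Carrier A) where
  open CommutativeRing A
  open RingProperties ring
  open SetoidReasoning setoid
  open Solver commutativeSemiring using (solve; _:=_; _:*_)

  infix 4 _≈ᶻ_
  -- Congruence modulo the annihilator of `z`. Carrier and operations stay the same and only
  -- equality becomes coarser, so decidability and homomorphisms carry over.
  _≈ᶻ_ : Carrier → Carrier → Set
  x ≈ᶻ y = x * z ≈ y * z

  ≈⇒≈ᶻ : ∀ {x y} → x ≈ y → x ≈ᶻ y
  ≈⇒≈ᶻ = *-congʳ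

  *-congᶻ : ∀ {x y u v} → x ≈ᶻ y → u ≈ᶻ v → x * u ≈ᶻ y * v
  *-congᶻ {x} {y} {u} {v} x≈y u≈v = begin
    (x * u) * z    ≈⟨ *-assoc x u z ⟩
    x * (u * z)    ≈⟨ *-congˡ u≈v ⟩
    x * (v * z)    ≈⟨ solve 3 (λ x v z → x :* (v :* z) := v :* (x :* z)) refl x v z ⟩
    v * (x * z)    ≈⟨ *-congˡ x≈y ⟩
    v * (y * z)    ≈⟨ solve 3 (λ v y z → v :* (y :* z) := (y :* v) :* z) refl v y z ⟩
    (y * v) * z    ∎

  annihilatorQuotient : CommutativeRing 0ℓ 0ℓ
  annihilatorQuotient = record
    { Carrier = Carrier ; _≈_ = _≈ᶻ_ ; _+_ = _+_ ; _*_ = _*_ ; -_ = -_ ; 0# = 0# ; 1# = 1#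
    ; isCommutativeRing = record
      { isRing = record
        { +-isAbelianGroup = record
          { isGroup = record
            { isMonoid = record
              { isSemigroup = record
                { isMagma = record
                  { isEquivalence = record { refl = refl ; sym = sym ; trans = trans }
                  ; ∙-cong = λ x≈y u≈v → trans (distribʳ z _ _) (trans (+-cong x≈y u≈v) (sym (distribʳ z _ _)))
                  }
                ; assoc = λ x y w → ≈⇒≈ᶻ (+-assoc x y w)
                }
              ; identity = (λ x → ≈⇒≈ᶻ (+-identityˡ x)) , λ x → ≈⇒≈ᶻ (+-identityʳ x)
              }
            ; inverse = (λ x → ≈⇒≈ᶻ (-‿inverseˡ x)) , λ x → ≈⇒≈ᶻ (-‿inverseʳ x)
            ; ⁻¹-cong = λ x≈y → trans (sym (-‿distribˡ-* _ z)) (trans (-‿cong x≈y) (-‿distribˡ-* _ z))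
            }
          ; comm = λ x y → ≈⇒≈ᶻ (+-comm x y)
          }
        ; *-cong = *-congᶻ
        ; *-assoc = λ x y w → ≈⇒≈ᶻ (*-assoc x y w)
        ; *-identity = (λ x → ≈⇒≈ᶻ (*-identityˡ x)) , λ x → ≈⇒≈ᶻ (*-identityʳ x)
        ; distrib = (λ x y w → ≈⇒≈ᶻ (distribˡ x y w)) , λ x y w → ≈⇒≈ᶻ (distribʳ x y w)
        }
      ; *-comm = λ x y → ≈⇒≈ᶻ (*-comm x y)
      }
    }

  quotient-isHom : (S : CommutativeRing 0ℓ 0ℓ) {f : CommutativeRing.Carrier S → Carrier} →
                   IsRingHomomorphism (CommutativeRing.rawRing S) rawRing f →
                   IsRingHomomorphism (CommutativeRing.rawRing S) (CommutativeRing.rawRing annihilatorQuotient) f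
  quotient-isHom S f-isHom = record
    { isSemiringHomomorphism = record
      { isNearSemiringHomomorphism = record
        { +-isMonoidHomomorphism = record
          { isMagmaHomomorphism = record
            { isRelHomomorphism = record { cong = λ a≈b → ≈⇒≈ᶻ (⟦⟧-cong a≈b) }
            ; homo = λ a b → ≈⇒≈ᶻ (+-homo a b)
            }
          ; ε-homo = ≈⇒≈ᶻ 0#-homo
          }
        ; *-homo = λ a b → ≈⇒≈ᶻ (*-homo a b)
        }
      ; 1#-homo = ≈⇒≈ᶻ 1#-homo
      }
    ; -‿homo = λ a → ≈⇒≈ᶻ (-‿homo a)
    }
    where open IsRingHomomorphism f-isHom

-- From a finite reduced algebra to a domain and its norm form.

module ReducedAlgebras {q : ℕ} (F : FiniteField q) where
  open Forms F using (AnisotropicForm)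
  private
    module F where
      open FiniteField F public
      open FieldElements F public

  module _ (A : CommutativeRing 0ℓ 0ℓ) (ι : F.Carrier → CommutativeRing.Carrier A)
    (ι-isHom : IsRingHomomorphism F.rawRing (CommutativeRing.rawRing A) ι) where
    open CommutativeRing A hiding (zero)
    open RingProperties ring
    open Exp commutativeSemiring using (_^_)
    open SetoidReasoning setoid
    open Solver commutativeSemiring using (solve; _:=_; _:*_)
    open AnnihilatorQuotients A
    open PrimeAnnihilators A using (primeAnnihilator)
    open Frobenius F A ι ι-isHom

    -- All conditions `frob j ξ ≉ ξ` are combined in one product, since factors that are separately
    -- nonzero need not all stay nonzero in a common domain quotient.
    moved : Carrier → ℕ → Carrier
    moved ξ zero    = 1#
    moved ξ (suc j) = (frob (suc j) ξ - ξ) * moved ξ j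

    module _ (_≟_ : ∀ x y → Dec (x ≈ y))
      {M : ℕ} (element : Fin M → Carrier) (element-surjective : ∀ x → Σ (Fin M) λ i → element i ≈ x)
      (reduced : ∀ x → x * x ≈ 0# → x ≈ 0#)
      (k : ℕ) (ξ : Carrier) (ξ-fixed : frob (suc k) ξ ≈ ξ) (moved≉0 : ¬ moved ξ k ≈ 0#) where

      private
        s : Carrier
        s = proj₁ (primeAnnihilator _≟_ element element-surjective (moved ξ k) moved≉0)

        z : Carrier
        z = moved ξ k * s

        z≉0 : ¬ z ≈ 0#
        z≉0 = proj₁ (proj₂ (primeAnnihilator _≟_ element element-surjective (moved ξ k) moved≉0))

        module K = CommutativeRing (annihilatorQuotient z)
        module KExp = Exp K.commutativeSemiring

        ≈⇒K : ∀ {x y} → x ≈ y → x K.≈ y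
        ≈⇒K = ≈⇒≈ᶻ z

        K≈0 : ∀ {x} → x K.≈ K.0# → x * z ≈ 0#
        K≈0 eq = trans eq (zeroˡ z)

        K^ : ∀ n x → x KExp.^ n ≡ x ^ n
        K^ zero    x = ≡.refl
        K^ (suc n) x = ≡.cong (x *_) (K^ n x)

        integral : ∀ {x y} → x * y K.≈ K.0# → x K.≈ K.0# ⊎ y K.≈ K.0#
        integral {x} {y} xy≈0 = Sum.map (λ eq → trans eq (sym (zeroˡ z))) (λ eq → trans eq (sym (zeroˡ z)))
          (proj₂ (proj₂ (primeAnnihilator _≟_ element element-surjective (moved ξ k) moved≉0)) x y (K≈0 xy≈0))

        moved-multiple : ∀ j {n} → 0 ℕ.< n → n ℕ.≤ j → (frob n ξ - ξ) * z ≈ 0# → moved ξ j * z ≈ 0#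
        moved-multiple zero    0<n n≤0 _  = contradiction n≤0 (ℕ.<⇒≱ 0<n)
        moved-multiple (suc j) {n} 0<n n≤1+j eq with n ℕ.≟ suc j
        ... | yes ≡.refl = begin
          (f * moved ξ j) * z          ≈⟨ solve 3 (λ x y z → (x :* y) :* z := y :* (x :* z)) refl f (moved ξ j) z ⟩
          moved ξ j * (f * z)          ≈⟨ *-congˡ eq ⟩
          moved ξ j * 0#               ≈⟨ zeroʳ _ ⟩
          0#                     ∎
          where f = frob (suc j) ξ - ξ
        ... | no n≢1+j = begin
          (f * moved ξ j) * z          ≈⟨ *-assoc f (moved ξ j) z ⟩
          f * (moved ξ j * z)          ≈⟨ *-congˡ (moved-multiple j 0<n (ℕ.s≤s⁻¹ (ℕ.≤∧≢⇒< n≤1+j n≢1+j)) eq) ⟩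
          f * 0#                 ≈⟨ zeroʳ f ⟩
          0#                     ∎
          where f = frob (suc j) ξ - ξ

        -- If `frob n` fixed ξ in the quotient, `moved ξ k` would annihilate `z`. As `z` is a
        -- multiple of `moved ξ k`, its square would be zero, against reducedness.
        ξ-moved : ∀ n → 0 ℕ.< n → n ℕ.< suc k → ¬ frob n ξ K.≈ ξ
        ξ-moved n 0<n (ℕ.s≤s n≤k) eq = z≉0 (reduced z (begin
          (moved ξ k * s) * z          ≈⟨ solve 3 (λ x y z → (x :* y) :* z := y :* (x :* z)) refl (moved ξ k) s z ⟩
          s * (moved ξ k * z)          ≈⟨ *-congˡ (moved-multiple k 0<n n≤k (trans ([y-z]x≈yx-zx z _ ξ) (x≈y⇒x∙y⁻¹≈ε eq))) ⟩
          s * 0#                 ≈⟨ zeroʳ s ⟩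
          0#                     ∎))

      reducedAlgebra⇒form : suc k ℕ.< q → AnisotropicForm (suc k)
      reducedAlgebra⇒form d<q = NormForms.normForm F (annihilatorQuotient z) ι (quotient-isHom z (FiniteField.commRing F) ι-isHom)
        (λ x y → (x * z) ≟ (y * z))
        (λ 1≈0 → z≉0 (trans (sym (*-identityˡ z)) (K≈0 1≈0)))
        integral (suc k) (ℕ.s≤s ℕ.z≤n) d<q ξ
        (K.trans (K.reflexive (K^ (q ℕ.^ suc k) ξ)) (≈⇒K ξ-fixed))
        (λ n 0<n n<d eq → ξ-moved n 0<n n<d (K.trans (K.reflexive (≡.sym (K^ (q ℕ.^ n) ξ))) eq))

-- Cyclic algebras: polynomials in the rotation of coordinates.

module CyclicAlgebras {q : ℕ} (F : FiniteField q) (m : ℕ) where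
  open FieldElements F
  open FiniteField F hiding (zero)
  open RingProperties ring
  open SetoidReasoning setoid
  open Solver commutativeSemiring using (solve; _:=_; _:+_; _:*_)

  V : Set
  V = Vect F (suc m)

  infix 4 _≋_
  _≋_ : V → V → Set
  u ≋ v = ∀ i → u i ≈ v i

  infixl 6 _⊕_
  _⊕_ : V → V → V
  (u ⊕ v) i = u i + v i

  infixr 7 _·_
  _·_ : Carrier → V → V
  (a · v) i = a * v i

  𝟘 : V
  𝟘 _ = 0#

  e₀ : V
  e₀ zero    = 1#
  e₀ (suc _) = 0#

  rotate : V → V
  rotate v zero    = v (fromℕ m)
  rotate v (suc i) = v (inject₁ i)

  record Linear (L : V → V) : Set where
    field
      L-cong : ∀ {u v} → u ≋ v → L u ≋ L v
      L-⊕    : ∀ u v → L (u ⊕ v) ≋ L u ⊕ L v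
      L-·    : ∀ a v → L (a · v) ≋ a · L v

    L-𝟘 : L 𝟘 ≋ 𝟘
    L-𝟘 i = trans (L-cong {𝟘} {0# · 𝟘} (λ _ → sym (zeroˡ 0#)) i) (trans (L-· 0# 𝟘 i) (zeroˡ _))

  rotate-linear : Linear rotate
  rotate-linear = record
    { L-cong = λ { u≋v zero → u≋v (fromℕ m) ; u≋v (suc i) → u≋v (inject₁ i) }
    ; L-⊕    = λ { u v zero → refl ; u v (suc i) → refl }
    ; L-·    = λ { a v zero → refl ; a v (suc i) → refl }
    }
  open Linear rotate-linear using () renaming (L-cong to rotate-cong; L-⊕ to rotate-⊕; L-· to rotate-·; L-𝟘 to rotate-𝟘)

  -- act u is the polynomial with coefficient vector u evaluated at the operator rotate.
  act : ∀ {n} → Vect F n → V → V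
  act {zero}  u v = 𝟘
  act {suc n} u v = u zero · v ⊕ rotate (act (u ∘ suc) v)

  act-linear : ∀ {n} (u : Vect F n) → Linear (act u)
  act-linear {zero}  u = record
    { L-cong = λ _ _ → refl
    ; L-⊕    = λ _ _ _ → sym (+-identityˡ 0#)
    ; L-·    = λ a _ _ → sym (zeroʳ a)
    }
  act-linear {suc n} u = record
    { L-cong = λ v≋w i → +-cong (*-congˡ (v≋w i)) (rotate-cong (L-cong v≋w) i)
    ; L-⊕    = λ v w i → begin
        u zero * (v i + w i) + rotate (act (u ∘ suc) (v ⊕ w)) i
          ≈⟨ +-congˡ (trans (rotate-cong (L-⊕ v w) i) (rotate-⊕ (act (u ∘ suc) v) (act (u ∘ suc) w) i)) ⟩
        u zero * (v i + w i) + (rotate (act (u ∘ suc) v) i + rotate (act (u ∘ suc) w) i)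
          ≈⟨ solve 5 (λ a x y b c → a :* (x :+ y) :+ (b :+ c) := (a :* x :+ b) :+ (a :* y :+ c)) refl _ _ _ _ _ ⟩
        act u v i + act u w i ∎
    ; L-·    = λ a v i → begin
        u zero * (a * v i) + rotate (act (u ∘ suc) (a · v)) i
          ≈⟨ +-congˡ (trans (rotate-cong (L-· a v) i) (rotate-· a (act (u ∘ suc) v) i)) ⟩
        u zero * (a * v i) + a * rotate (act (u ∘ suc) v) i
          ≈⟨ solve 4 (λ b a x y → b :* (a :* x) :+ a :* y := a :* (b :* x :+ y)) refl _ _ _ _ ⟩
        a * act u v i ∎
    }
    where open Linear (act-linear (u ∘ suc))

  -- The source of commutativity and associativity of the product: as a polynomial in `rotate`,
  -- `act u` commutes with whatever linear map commutes with `rotate`, in particular with every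
  -- `act w`.
  act-commute : ∀ {L} → Linear L → (∀ v → L (rotate v) ≋ rotate (L v)) →
                ∀ {n} (u : Vect F n) v → L (act u v) ≋ act u (L v)
  act-commute lin comm {zero}  u v i = Linear.L-𝟘 lin i
  act-commute {L} lin comm {suc n} u v i = begin
    L (u zero · v ⊕ rotate (act (u ∘ suc) v)) i        ≈⟨ L-⊕ (u zero · v) _ i ⟩
    L (u zero · v) i + L (rotate (act (u ∘ suc) v)) i  ≈⟨ +-cong (L-· (u zero) v i)
      (trans (comm _ i) (rotate-cong (act-commute lin comm (u ∘ suc) v) i)) ⟩
    act u (L v) i                                      ∎
    where open Linear lin

  act-rotate : ∀ {n} (u : Vect F n) v → act u (rotate v) ≋ rotate (act u v)
  act-rotate u v i = sym (act-commute rotate-linear (λ _ _ → refl) u v i)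

  act-act : ∀ {n k} (u : Vect F n) (w : Vect F k) v → act u (act w v) ≋ act w (act u v)
  act-act u = act-commute (act-linear u) (act-rotate u)

  -- As `n ≤ suc m`, no coefficient wraps around, so `act u e₀` is `u` padded with zeros; this lemma
  -- and the next check the positions from `n` on and below `n`.
  act-e₀-above : ∀ {n} (u : Vect F n) → n ℕ.≤ suc m → ∀ i → n ℕ.≤ toℕ i → act u e₀ i ≈ 0#
  act-e₀-above {zero}  u _ i _ = refl
  act-e₀-above {suc n} u n<N (suc i) (ℕ.s≤s n≤i) = trans (+-cong (zeroʳ _)
    (act-e₀-above (u ∘ suc) (ℕ.<⇒≤ n<N) (inject₁ i) (≡.subst (n ℕ.≤_) (≡.sym (Fin.toℕ-inject₁ i)) n≤i)))
    (+-identityˡ 0#)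

  act-e₀-below : ∀ {n} (u : Vect F n) → n ℕ.≤ suc m → ∀ i j → toℕ i ≡ toℕ j → act u e₀ i ≈ u j
  act-e₀-below {suc n} u (ℕ.s≤s n≤m) zero zero _ = trans (+-cong (*-identityʳ _)
    (act-e₀-above (u ∘ suc) (ℕ.m≤n⇒m≤1+n n≤m) (fromℕ m) (≡.subst (n ℕ.≤_) (≡.sym (Fin.toℕ-fromℕ m)) n≤m)))
    (+-identityʳ _)
  act-e₀-below {suc n} u n<N (suc i) (suc j) eq = trans (+-cong (zeroʳ _)
    (act-e₀-below (u ∘ suc) (ℕ.<⇒≤ n<N) (inject₁ i) j (≡.trans (Fin.toℕ-inject₁ i) (ℕ.suc-injective eq))))
    (+-identityˡ _)

  act-e₀ : ∀ u → act u e₀ ≋ u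
  act-e₀ u i = act-e₀-below u ℕ.≤-refl i i ≡.refl

  -- By `act-e₀` every vector is a polynomial in `rotate` applied to `e₀`, and these polynomials
  -- commute.
  act-comm : ∀ (u v : V) → act u v ≋ act v u
  act-comm u v i = begin
    act u v i           ≈⟨ L-cong (act-linear u) (act-e₀ v) i ⟨
    act u (act v e₀) i  ≈⟨ act-act u v e₀ i ⟩
    act v (act u e₀) i  ≈⟨ L-cong (act-linear v) (act-e₀ u) i ⟩
    act v u i           ∎
    where open Linear

  act-assoc : ∀ (u v w : V) → act (act u v) w ≋ act u (act v w)
  act-assoc u v w i = begin
    act (act u v) w i   ≈⟨ act-comm (act u v) w i ⟩
    act w (act u v) i   ≈⟨ act-act w u v i ⟩
    act u (act w v) i   ≈⟨ Linear.L-cong (act-linear u) (act-comm w v) i ⟩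
    act u (act v w) i   ∎

  act-congˡ : ∀ {u u′ : V} v → u ≋ u′ → act u v ≋ act u′ v
  act-congˡ {u} {u′} v u≋u′ i = trans (act-comm u v i)
    (trans (Linear.L-cong (act-linear v) u≋u′ i) (act-comm v u′ i))

  act-distribˡ : ∀ (u v w : V) → act (v ⊕ w) u ≋ act v u ⊕ act w u
  act-distribˡ u v w i = trans (act-comm (v ⊕ w) u i) (trans (Linear.L-⊕ (act-linear u) v w i)
    (+-cong (act-comm u v i) (act-comm u w i)))

  -- The algebra F[X]/(X^(m+1) - 1): multiplication by X is rotation of coefficients.
  cyclicAlgebra : CommutativeRing 0ℓ 0ℓ
  cyclicAlgebra = record
    { Carrier = V ; _≈_ = _≋_ ; _+_ = _⊕_ ; _*_ = act ; -_ = λ v i → - v i ; 0# = 𝟘 ; 1# = e₀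
    ; isCommutativeRing = record
      { isRing = record
        { +-isAbelianGroup = record
          { isGroup = record
            { isMonoid = record
              { isSemigroup = record
                { isMagma = record
                  { isEquivalence = record
                    { refl = λ _ → refl ; sym = λ u≋v i → sym (u≋v i) ; trans = λ u≋v v≋w i → trans (u≋v i) (v≋w i) }
                  ; ∙-cong = λ u≋u′ v≋v′ i → +-cong (u≋u′ i) (v≋v′ i)
                  }
                ; assoc = λ u v w i → +-assoc (u i) (v i) (w i)
                }
              ; identity = (λ v i → +-identityˡ (v i)) , λ v i → +-identityʳ (v i)
              }
            ; inverse = (λ v i → -‿inverseˡ (v i)) , λ v i → -‿inverseʳ (v i)
            ; ⁻¹-cong = λ u≋v i → -‿cong (u≋v i)
            }
          ; comm = λ u v i → +-comm (u i) (v i)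
          }
        ; *-cong = λ {u} {u′} {v} {v′} u≋u′ v≋v′ i → trans (act-congˡ v u≋u′ i) (Linear.L-cong (act-linear u′) v≋v′ i)
        ; *-assoc = act-assoc
        ; *-identity = (λ v i → trans (act-comm e₀ v i) (act-e₀ v i)) , act-e₀
        ; distrib = (λ u → Linear.L-⊕ (act-linear u)) , act-distribˡ
        }
      ; *-comm = act-comm
      }
    }

  ι : Carrier → V
  ι a = a · e₀

  ι-isHom : IsRingHomomorphism rawRing (CommutativeRing.rawRing cyclicAlgebra) ι
  ι-isHom = record
    { isSemiringHomomorphism = record
      { isNearSemiringHomomorphism = record
        { +-isMonoidHomomorphism = record
          { isMagmaHomomorphism = record
            { isRelHomomorphism = record { cong = λ a≈b i → *-congʳ a≈b }
            ; homo = λ a b i → distribʳ (e₀ i) a b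
            }
          ; ε-homo = λ i → zeroˡ (e₀ i)
          }
        ; *-homo = λ a b i → begin
            (a * b) * e₀ i            ≈⟨ *-congʳ (*-comm a b) ⟩
            (b * a) * e₀ i            ≈⟨ *-assoc b a (e₀ i) ⟩
            b * ι a i                 ≈⟨ *-congˡ (act-e₀ (ι a) i) ⟨
            b * act (ι a) e₀ i        ≈⟨ Linear.L-· (act-linear (ι a)) b e₀ i ⟨
            act (ι a) (ι b) i         ∎
        }
      ; 1#-homo = λ i → *-identityˡ (e₀ i)
      }
    ; -‿homo = λ a i → sym (-‿distribˡ-* a (e₀ i))
    }

-- Existence of anisotropic forms in each degree below q.

module FormExistence {q : ℕ} (F : FiniteField q) where
  open ReducedAlgebras F using (moved; reducedAlgebra⇒form)
  open Forms F using (AnisotropicForm)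
  private
    module F where
      open FiniteField F public
      open FieldElements F public

  -- The degree is d = `suc k`, and the rotation length `suc m` is q^d - 1.
  module _ (k m : ℕ) (q^d≡2+m : q ℕ.^ suc k ≡ suc (suc m)) where
    open CyclicAlgebras F m
    open CommutativeRing cyclicAlgebra hiding (zero)
    open RingProperties ring
    open Exp commutativeSemiring using (_^_; ^-congʳ)
    open SetoidReasoning setoid
    open Polynomials cyclicAlgebra using (eval; eval-cong)
    open Frobenius F cyclicAlgebra ι ι-isHom

    private
      ξ : V
      ξ = rotate e₀

      ξ* : ∀ x → ξ * x ≈ rotate x
      ξ* x = begin
        ξ * x              ≈⟨ *-comm ξ x ⟩
        act x (rotate e₀)  ≈⟨ act-rotate x e₀ ⟩
        rotate (act x e₀)  ≈⟨ Linear.L-cong rotate-linear (act-e₀ x) ⟩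
        rotate x           ∎

      rotateBy : ℕ → V → V
      rotateBy zero    x = x
      rotateBy (suc n) x = rotate (rotateBy n x)

      ξ^* : ∀ n x → ξ ^ n * x ≈ rotateBy n x
      ξ^* zero    x = *-identityˡ x
      ξ^* (suc n) x = begin
        (ξ * ξ ^ n) * x        ≈⟨ *-assoc ξ (ξ ^ n) x ⟩
        ξ * (ξ ^ n * x)        ≈⟨ ξ* _ ⟩
        rotate (ξ ^ n * x)     ≈⟨ Linear.L-cong rotate-linear (ξ^* n x) ⟩
        rotateBy (suc n) x     ∎

      -- Quantifying over indices makes this vacuous for degrees beyond `m`, so rotation raises the
      -- degree by one without any bound on `n`.
      Monic : ℕ → V → Set
      Monic n x = (∀ i → toℕ i ≡ n → x i F.≈ F.1#) × (∀ i → n ℕ.< toℕ i → x i F.≈ F.0#)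

      monic-cong : ∀ {n x y} → x ≈ y → Monic n x → Monic n y
      monic-cong x≈y (one , above) =
        (λ i eq → F.trans (F.sym (x≈y i)) (one i eq)) , λ i lt → F.trans (F.sym (x≈y i)) (above i lt)

      monic-rotate : ∀ {n x} → Monic n x → Monic (suc n) (rotate x)
      monic-rotate {n} {x} (one , above) =
        (λ { (suc i) eq → one (inject₁ i) (≡.trans (Fin.toℕ-inject₁ i) (ℕ.suc-injective eq)) }) ,
        (λ { (suc i) (ℕ.s≤s lt) → above (inject₁ i) (≡.subst (n ℕ.<_) (≡.sym (Fin.toℕ-inject₁ i)) lt) })

      monic-rotateBy : ∀ j {n x} → Monic n x → Monic (j ℕ.+ n) (rotateBy j x)
      monic-rotateBy zero    mon = mon
      monic-rotateBy (suc j) mon = monic-rotate (monic-rotateBy j mon)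

      monic-sub : ∀ {n n′ x y} → n′ ℕ.< n → Monic n x → Monic n′ y → Monic n (x - y)
      monic-sub n′<n (one , above) (_ , above′) =
        (λ i eq → F.trans (F.+-cong (one i eq) (F.trans (F.-‿cong (above′ i (≡.subst (_ ℕ.<_) (≡.sym eq) n′<n))) -0≈0))
                          (F.+-identityʳ _)) ,
        (λ i lt → F.trans (F.+-cong (above i lt) (F.trans (F.-‿cong (above′ i (ℕ.<-trans n′<n lt))) -0≈0))
                          (F.+-identityʳ _))
        where
        -0≈0 : F.- F.0# F.≈ F.0#
        -0≈0 = RingProperties.-0#≈0# F.ring

      T : ℕ → V
      T = moved cyclicAlgebra ι ι-isHom ξ

      degT : ℕ → ℕ
      degT zero    = 0
      degT (suc j) = q ℕ.^ suc j ℕ.+ degT j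

      1<q^suc : ∀ j → 1 ℕ.< q ℕ.^ suc j
      1<q^suc j = ℕ.<-≤-trans F.1<q (ℕ.≤-trans (ℕ.≤-reflexive (≡.sym (ℕ.*-identityʳ q)))
        (ℕ.*-monoʳ-≤ q (ℕ.m^n>0 q {{ℕ.>-nonZero (ℕ.<-trans (ℕ.s≤s ℕ.z≤n) F.1<q)}} j)))

      -- Multiplication by X^(q^(j+1)) - X is the difference of two rotations, by q^(j+1) and by 1,
      -- and the first has the higher degree.
      T-monic : ∀ j → Monic (degT j) (T j)
      T-monic zero    = (λ { zero _ → F.refl }) , λ { (suc i) _ → F.refl }
      T-monic (suc j) = monic-cong (sym (begin
        (frob (suc j) ξ - ξ) * T j                    ≈⟨ [y-z]x≈yx-zx (T j) (frob (suc j) ξ) ξ ⟩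
        frob (suc j) ξ * T j - ξ * T j                ≈⟨ +-cong (ξ^* (q ℕ.^ suc j) (T j)) (-‿cong (ξ* (T j))) ⟩
        rotateBy (q ℕ.^ suc j) (T j) - rotate (T j)   ∎))
        (monic-sub (ℕ.+-monoˡ-< (degT j) (1<q^suc j))
          (monic-rotateBy (q ℕ.^ suc j) (T-monic j)) (monic-rotate (T-monic j)))

      -- As q ≥ 2, the geometric sum q + ... + q^j is at most q^(j+1) - 2. Hence the leading
      -- coefficient of `T k` sits at an index below the rotation length.
      degT+2≤q^ : ∀ j → degT j ℕ.+ 2 ℕ.≤ q ℕ.^ suc j
      degT+2≤q^ zero    = 1<q^suc 0
      degT+2≤q^ (suc j) = ℕR.begin
        (q ℕ.^ suc j ℕ.+ degT j) ℕ.+ 2       ℕR.≡⟨ ℕ.+-assoc (q ℕ.^ suc j) (degT j) 2 ⟩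
        q ℕ.^ suc j ℕ.+ (degT j ℕ.+ 2)       ℕR.≤⟨ ℕ.+-monoʳ-≤ (q ℕ.^ suc j) (degT+2≤q^ j) ⟩
        q ℕ.^ suc j ℕ.+ q ℕ.^ suc j          ℕR.≡⟨ ≡.cong (q ℕ.^ suc j ℕ.+_) (ℕ.+-identityʳ _) ⟨
        2 ℕ.* q ℕ.^ suc j                    ℕR.≤⟨ ℕ.*-monoˡ-≤ (q ℕ.^ suc j) F.1<q ⟩
        q ℕ.^ suc (suc j)                    ℕR.∎
        where module ℕR = ℕ.≤-Reasoning

      T≉0 : ¬ T k ≈ 0#
      T≉0 T≈0 = F.0≉1 (F.trans (F.sym (T≈0 i)) (proj₁ (T-monic k) i (Fin.toℕ-fromℕ< degT<N)))
        where
        degT<N : degT k ℕ.< suc m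
        degT<N = ℕ.s≤s (ℕ.s≤s⁻¹ (ℕ.s≤s⁻¹ (≡.subst₂ ℕ._≤_ (ℕ.+-comm (degT k) 2) q^d≡2+m (degT+2≤q^ k))))
        i : Fin (suc m)
        i = fromℕ< degT<N

      rotateBy-e₀ : ∀ n → n ℕ.≤ m → ∀ i → (toℕ i ≡ n → rotateBy n e₀ i F.≈ F.1#) × (toℕ i ≢ n → rotateBy n e₀ i F.≈ F.0#)
      rotateBy-e₀ zero    _   zero    = (λ _ → F.refl) , λ 0≢0 → contradiction ≡.refl 0≢0
      rotateBy-e₀ zero    _   (suc i) = (λ ()) , λ _ → F.refl
      rotateBy-e₀ (suc n) n<m zero    = (λ ()) , λ _ → proj₂ (rotateBy-e₀ n (ℕ.<⇒≤ n<m) (fromℕ m))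
        λ eq → ℕ.<-irrefl (≡.trans (≡.sym eq) (Fin.toℕ-fromℕ m)) n<m
      rotateBy-e₀ (suc n) n<m (suc i) =
        (λ eq → proj₁ IH (≡.trans (Fin.toℕ-inject₁ i) (ℕ.suc-injective eq))) ,
        (λ neq → proj₂ IH (neq ∘ ≡.cong suc ∘ ≡.trans (≡.sym (Fin.toℕ-inject₁ i))))
        where IH = rotateBy-e₀ n (ℕ.<⇒≤ n<m) (inject₁ i)

      rotateBy-period : rotateBy (suc m) e₀ ≈ e₀
      rotateBy-period zero    = proj₁ (rotateBy-e₀ m ℕ.≤-refl (fromℕ m)) (Fin.toℕ-fromℕ m)
      rotateBy-period (suc i) = proj₂ (rotateBy-e₀ m ℕ.≤-refl (inject₁ i))
        λ eq → ℕ.<-irrefl (≡.trans (≡.sym (Fin.toℕ-inject₁ i)) eq) (Fin.toℕ<n i)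

      ξ-fixed : frob (suc k) ξ ≈ ξ
      ξ-fixed = begin
        ξ ^ (q ℕ.^ suc k)              ≈⟨ ^-congʳ ξ q^d≡2+m ⟩
        ξ * ξ ^ suc m              ≈⟨ *-congˡ {ξ} (*-identityʳ (ξ ^ suc m)) ⟨
        ξ * (ξ ^ suc m * 1#)       ≈⟨ *-congˡ {ξ} (trans (ξ^* (suc m) 1#) rotateBy-period) ⟩
        ξ * 1#                     ≈⟨ *-identityʳ ξ ⟩
        ξ                          ∎

      act-eval : ∀ {n} (u : Vect F n) → act u e₀ ≈ eval (ι ∘ u) ξ
      act-eval {zero}  u = refl
      act-eval {suc n} u = +-cong (refl {ι (u zero)}) (trans (Linear.L-cong rotate-linear (act-eval (u ∘ suc))) (sym (ξ* _)))

      -- `frob (suc k)` respects sums and products and fixes ξ and all scalars, and every element is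
      -- a polynomial in ξ over F.
      frob-d : ∀ x → frob (suc k) x ≈ x
      frob-d x = begin
        frob (suc k) x                             ≈⟨ frob-cong (suc k) x≈ ⟩
        frob (suc k) (eval (ι ∘ x) ξ)              ≈⟨ frob-eval (suc k) (ι ∘ x) ξ ⟩
        eval (frob (suc k) ∘ ι ∘ x) (frob (suc k) ξ)     ≈⟨ eval-cong _ (ι ∘ x) (λ i → frob-ι (suc k) (x i)) ξ-fixed ⟩
        eval (ι ∘ x) ξ                       ≈⟨ x≈ ⟨
        x                                    ∎
        where
        x≈ : x ≈ eval (ι ∘ x) ξ
        x≈ = trans (sym (act-e₀ x)) (act-eval x)

      -- By `frob-d`, `x` equals its power with exponent q^d ≥ 2, which is a multiple of `x * x`.
      reduced : ∀ x → x * x ≈ 0# → x ≈ 0#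
      reduced x x²≈0 = begin
        x                      ≈⟨ frob-d x ⟨
        x ^ (q ℕ.^ suc k)          ≈⟨ ^-congʳ x q^d≡2+m ⟩
        x * (x * x ^ m)        ≈⟨ *-assoc x x _ ⟨
        (x * x) * x ^ m        ≈⟨ *-congʳ x²≈0 ⟩
        0# * x ^ m             ≈⟨ zeroˡ _ ⟩
        0#                     ∎

      _≟_ : ∀ x y → Dec (x ≈ y)
      x ≟ y = Fin.all? λ i → x i F.≟ y i

      element : Fin (q ℕ.^ suc m) → V
      element j i = F.el (finToFun j i)

      element-surjective : ∀ x → Σ (Fin (q ℕ.^ suc m)) λ j → element j ≈ x
      element-surjective x = funToFin (F.idx ∘ x) , λ i →
        F.trans (F.reflexive (≡.cong F.el (Fin.finToFun-funToFin (F.idx ∘ x) i))) (F.el-idx (x i))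

    cyclic⇒form : suc k ℕ.< q → AnisotropicForm (suc k)
    cyclic⇒form = reducedAlgebra⇒form cyclicAlgebra ι ι-isHom _≟_ element element-surjective reduced k ξ ξ-fixed T≉0

  abstract
    anisotropicForm : ∀ k → suc k ℕ.< q → AnisotropicForm (suc k)
    anisotropicForm k = cyclic⇒form k (q ℕ.^ suc k ℕ.∸ 2) (≡.sym (ℕ.m+[n∸m]≡n 2≤q^))
      where
      2≤q^ : 2 ℕ.≤ q ℕ.^ suc k
      2≤q^ = ℕ.≤-trans F.1<q (ℕ.≤-trans (ℕ.≤-reflexive (≡.sym (ℕ.*-identityʳ q)))
        (ℕ.*-monoʳ-≤ q (ℕ.m^n>0 q {{ℕ.>-nonZero (ℕ.<-trans (ℕ.s≤s ℕ.z≤n) F.1<q)}} k)))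

-- The pigeonhole principle and triangular numbers.

module Pigeonhole where
  open import Data.Nat using (_+_; _*_; _<_)
  open import Data.List using (List; []; _∷_; length; filter; lookup; allFin)
  import Data.List.Properties as List
  open import Data.List.Relation.Unary.All as All using (All; []; _∷_)
  import Data.List.Relation.Unary.All.Properties as All
  open import Data.List.Relation.Unary.AllPairs using (_∷_)
  open import Data.List.Relation.Unary.Unique.Propositional using (Unique)
  import Data.List.Relation.Unary.Unique.Propositional.Properties as Unique
  open import Data.List.Membership.Propositional.Properties using (∈-lookup)
  open import Relation.Binary.PropositionalEquality using (_≡_; refl; sym; trans; cong; subst)

  lookup-injective : ∀ {A : Set} {xs : List A} → Unique xs → ∀ i j → lookup xs i ≡ lookup xs j → i ≡ j
  lookup-injective (_ ∷ _)    zero    zero    _  = refl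
  lookup-injective (x∉ ∷ _)   zero    (suc j) eq = contradiction eq (All.lookup x∉ (∈-lookup j))
  lookup-injective (x∉ ∷ _)   (suc i) zero    eq = contradiction (sym eq) (All.lookup x∉ (∈-lookup i))
  lookup-injective (_ ∷ uniq) (suc i) (suc j) eq = cong suc (lookup-injective uniq i j eq)

  length-filter-+ : ∀ {A : Set} {P : A → Set} (P? : ∀ x → Dec (P x)) xs →
                    length xs ≡ length (filter P? xs) + length (filter (¬? ∘ P?) xs)
  length-filter-+ P? []       = refl
  length-filter-+ P? (x ∷ xs) with P? x
  ... | yes _ = cong suc (length-filter-+ P? xs)
  ... | no  _ = trans (cong suc (length-filter-+ P? xs)) (sym (ℕ.+-suc _ _))

  -- Induction on the number of values: either the fibre of the largest value has more than `D`
  -- elements, or discarding it costs at most `D` elements and leaves one value fewer.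
  large-fibre-list : ∀ {A : Set} (g : A → ℕ) s D (xs : List A) → Unique xs → All (λ x → g x < s) xs →
                     s * D < length xs →
                     Σ (List A) λ ys → Unique ys × D < length ys × (Σ ℕ λ c → All (λ y → g y ≡ c) ys)
  large-fibre-list g zero    D (x ∷ xs) _    (() ∷ _) _
  large-fibre-list g (suc s) D xs       uniq bounded  lt
    with D ℕ.<? length (filter (λ x → g x ℕ.≟ s) xs)
  ... | yes D< = filter (λ x → g x ℕ.≟ s) xs , Unique.filter⁺ (λ x → g x ℕ.≟ s) uniq , D< , s , All.all-filter (λ x → g x ℕ.≟ s) xs
  ... | no  D≮ = large-fibre-list g s D rest (Unique.filter⁺ (¬? ∘ (λ x → g x ℕ.≟ s)) uniq)
    (All.zipWith (λ { (gx<1+s , gx≢s) → ℕ.≤∧≢⇒< (ℕ.s≤s⁻¹ gx<1+s) gx≢s })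
      (All.filter⁺ (¬? ∘ (λ x → g x ℕ.≟ s)) bounded , All.all-filter (¬? ∘ (λ x → g x ℕ.≟ s)) xs))
    (ℕ.+-cancelˡ-< D _ _ (ℕ.<-≤-trans lt (ℕ.≤-trans (ℕ.≤-reflexive (length-filter-+ (λ x → g x ℕ.≟ s) xs))
      (ℕ.+-monoˡ-≤ (length rest) (ℕ.≮⇒≥ D≮)))))
    where rest = filter (¬? ∘ (λ x → g x ℕ.≟ s)) xs

  -- The fibre is given as an injective family of `suc D` indices, the form in which `vanishing⇒≈0`
  -- takes its roots.
  large-fibre : ∀ {n} (g : Fin n → ℕ) s D → (∀ i → g i < s) → s * D < n →
                Σ (Fin (suc D) → Fin n) λ τ → (∀ i j → τ i ≡ τ j → i ≡ j) × (∀ i j → g (τ i) ≡ g (τ j))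
  large-fibre {n} g s D g<s lt
    with large-fibre-list g s D (allFin n) (Unique.allFin⁺ n) (All.universal g<s (allFin n))
           (subst (s * D <_) (sym (List.length-tabulate (λ i → i))) lt)
  ... | ys , uniq , D< , c , all≡c = (λ i → lookup ys (inject≤ i D<))
    , (λ i j eq → Fin.inject≤-injective D< D< i j (lookup-injective uniq _ _ eq))
    , (λ i j → trans (value (inject≤ i D<)) (sym (value (inject≤ j D<))))
    where
    value : ∀ i → g (lookup ys i) ≡ c
    value i = All.lookup all≡c (∈-lookup i)

  triangular : ℕ → ℕ
  triangular zero    = 0
  triangular (suc D) = suc D + triangular D

-- Colourings of affine space from polynomials.

module AffineColorings {q : ℕ} (F : FiniteField q) where
  open FiniteField F hiding (zero)
  open RingProperties ring
  open SetoidReasoning setoid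
  open FieldElements F
  open Polynomials commRing
  open Forms F
  open Pigeonhole
  open FormExistence F using (anisotropicForm)

  zero? : ∀ {n} (v : Vect F n) → Dec (IsZero F v)
  zero? v = Fin.all? λ i → v i ≟ 0#

  isZero-split : ∀ m {n} {x : Vect F (m ℕ.+ n)} → IsZero F (x ∘ (_↑ˡ n)) → IsZero F (x ∘ (m ↑ʳ_)) → IsZero F x
  isZero-split m {n} {x} l r i with splitAt m i in eq
  ... | inj₁ j = ≡.subst (λ i → x i ≈ 0#) (Fin.splitAt⁻¹-↑ˡ eq) (l j)
  ... | inj₂ j = ≡.subst (λ i → x i ≈ 0#) (Fin.splitAt⁻¹-↑ʳ eq) (r j)

  -- Nonconstancy on a line is stated through the coefficients of positive degree; for `D < q` it
  -- amounts to nonconstancy of the values.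
  record AffinePolynomial (D M : ℕ) : Set where
    field
      poly      : Vect F M → Carrier
      poly-cong : ∀ {x y : Vect F M} → (∀ i → x i ≈ y i) → poly x ≈ poly y
      poly-line : ∀ (y v : Vect F M) → Σ (Fin (suc D) → Carrier) λ b →
                  (∀ a → poly (λ i → y i + a * v i) ≈ eval b a) × ((∀ i → b (suc i) ≈ 0#) → IsZero F v)

  -- The sum of anisotropic forms of degrees 1, …, D in disjoint sets of variables: on a line, the
  -- leading term comes from the largest degree for which the direction has a nonzero component.
  affinePolynomial : ∀ D → D ℕ.< q → AffinePolynomial D (triangular D)
  affinePolynomial zero _ = record
    { poly      = λ _ → 0#
    ; poly-cong = λ _ → refl
    ; poly-line = λ y v → (λ _ → 0#) , (λ a → sym (trans (+-identityˡ _) (zeroʳ a))) , λ _ ()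
    }
  affinePolynomial (suc D) D<q = record
    { poly      = λ x → form (x ∘ (_↑ˡ triangular D)) + poly (x ∘ (suc D ↑ʳ_))
    ; poly-cong = λ x≈y → +-cong (form-cong (λ i → x≈y (i ↑ˡ triangular D))) (poly-cong (λ i → x≈y (suc D ↑ʳ i)))
    ; poly-line = line
    }
    where
    open AffinePolynomial (affinePolynomial D (ℕ.<-trans (ℕ.n<1+n D) D<q))
    open AnisotropicForm (anisotropicForm D D<q)
    line : ∀ (y v : Vect F (triangular (suc D))) → Σ (Fin (suc (suc D)) → Carrier) λ b →
           (∀ a → form (λ i → y (i ↑ˡ triangular D) + a * v (i ↑ˡ triangular D)) +
                  poly (λ i → y (suc D ↑ʳ i) + a * v (suc D ↑ʳ i)) ≈ eval b a) ×
           ((∀ i → b (suc i) ≈ 0#) → IsZero F v)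
    line y v with form-line (y ∘ (_↑ˡ triangular D)) (v ∘ (_↑ˡ triangular D))
                | poly-line (y ∘ (suc D ↑ʳ_)) (v ∘ (suc D ↑ʳ_))
                | zero? (v ∘ (_↑ˡ triangular D))
    ... | b₁ , on-line₁ , zero₁ | b₂ , on-line₂ , zero₂ | no v₁≉0 =
      (λ i → b₁ i + b i) ,
      (λ a → begin
        _ + _                                      ≈⟨ +-cong (on-line₁ a) (on-line₂ a) ⟩
        eval b₁ a + eval b₂ a                      ≈⟨ +-congˡ (eval-b a) ⟨
        eval b₁ a + eval b a                       ≈⟨ eval-+ b₁ b a ⟨
        eval (λ i → b₁ i + b i) a                  ∎) ,
      λ tail≈0 → contradiction (zero₁ (begin
        b₁ (fromℕ (suc D))                         ≈⟨ +-identityʳ _ ⟨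
        b₁ (fromℕ (suc D)) + 0#                    ≈⟨ +-congˡ (reflexive (snoc-last b₂ 0#)) ⟨
        b₁ (fromℕ (suc D)) + b (fromℕ (suc D))     ≈⟨ tail≈0 (fromℕ D) ⟩
        0#                                         ∎)) v₁≉0
      where
      b : Fin (suc (suc D)) → Carrier
      b = snoc b₂ 0#
      eval-b : ∀ a → eval b a ≈ eval b₂ a
      eval-b a = trans (eval-snoc b₂ 0# a) (trans (+-congˡ (zeroˡ _)) (+-identityʳ _))
    ... | _ | b₂ , on-line₂ , zero₂ | yes v₁≈0 =
      -- The form of degree `suc D` is constant on this line, so it only contributes to the constant
      -- term; subtracting its negative adds it.
      subConst (snoc b₂ 0#) (- form y₁) ,
      (λ a → begin
        form _ + poly _                            ≈⟨ +-cong (form-cong (λ i → trans (+-congˡ (trans (*-congˡ (v₁≈0 i)) (zeroʳ a))) (+-identityʳ _))) (on-line₂ a) ⟩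
        form y₁ + eval b₂ a                        ≈⟨ +-comm _ _ ⟩
        eval b₂ a + form y₁                        ≈⟨ +-cong (trans (eval-snoc b₂ 0# a) (trans (+-congˡ (zeroˡ _)) (+-identityʳ _))) (-‿involutive _) ⟨
        eval (snoc b₂ 0#) a - (- form y₁)          ≈⟨ eval-subConst (snoc b₂ 0#) (- form y₁) a ⟨
        eval (subConst (snoc b₂ 0#) (- form y₁)) a ∎) ,
      λ tail≈0 → isZero-split (suc D) v₁≈0 (zero₂ λ i →
        trans (sym (reflexive (snoc-inject₁ b₂ 0# (suc i)))) (tail≈0 (inject₁ i)))
      where
      y₁ : Vect F (suc D)
      y₁ = y ∘ (_↑ˡ triangular D)

  record AffineColoring (M k : ℕ) : Set where
    field
      color       : Vect F M → Fin k
      color-cong  : ∀ {x y : Vect F M} → (∀ i → x i ≈ y i) → color x ≡ color y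
      nonconstant : ∀ (y v : Vect F M) → ¬ IsZero F v → ¬ (∀ a → color (λ i → y i + a * v i) ≡ color y)

  -- Every value of the polynomial is taken at most D times on a line, and each residue class
  -- modulo k contains at most 1 + (q - 1) / k of the q indices.
  affineColoring : ∀ {D M} → AffinePolynomial D M → ∀ k .{{_ : ℕ.NonZero k}} →
                   suc ((q ℕ.∸ 1) / k) ℕ.* D ℕ.< q → AffineColoring M k
  affineColoring {D} {M} P k small = record
    { color       = λ y → index (poly y) mod k
    ; color-cong  = λ x≈y → ≡.cong (λ i → toℕ i mod k) (idx-cong (poly-cong x≈y))
    ; nonconstant = λ y v v≉0 const → v≉0 (constant⇒zero y v const)
    }
    where
    open AffinePolynomial P
    index : Carrier → ℕ
    index = toℕ ∘ idx

    index≤q-1 : ∀ a → index a ℕ.≤ q ℕ.∸ 1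
    index≤q-1 a = ℕ.pred-mono-≤ (Fin.toℕ<n (idx a))

    same-class : ∀ {a b} → index a mod k ≡ index b mod k → index a / k ≡ index b / k → a ≈ b
    same-class {a} {b} mod≡ div≡ = idx-injective (Fin.toℕ-injective (≡.trans (m≡m%n+[m/n]*n (index a) k)
      (≡.trans (≡.cong₂ (λ r d → r ℕ.+ d ℕ.* k) rem≡ div≡) (≡.sym (m≡m%n+[m/n]*n (index b) k)))))
      where
      rem≡ : index a % k ≡ index b % k
      rem≡ = ≡.trans (≡.sym (Fin.toℕ-fromℕ< (m%n<n (index a) k)))
        (≡.trans (≡.cong toℕ mod≡) (Fin.toℕ-fromℕ< (m%n<n (index b) k)))

    constant⇒zero : ∀ (y v : Vect F M) →
      (∀ a → index (poly (λ i → y i + a * v i)) mod k ≡ index (poly y) mod k) → IsZero F v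
    constant⇒zero y v const
      -- If all points share a residue modulo `k`, then among some `suc D` of them the quotient by
      -- `k` also agrees, hence the index and the value of the polynomial.
      with poly-line y v
         | large-fibre (λ i → index (poly (λ j → y j + el i * v j)) / k) (suc ((q ℕ.∸ 1) / k)) D
             (λ i → ℕ.s≤s (/-monoˡ-≤ k (index≤q-1 (poly (λ j → y j + el i * v j))))) small
    ... | b , on-line , tail≈0⇒zero | τ , τ-injective , τ-same =
      tail≈0⇒zero λ i → vanishing⇒≈0 (subConst b c) (el ∘ τ) regular roots (suc i)
      where
      value : Fin q → Carrier
      value i = poly (λ j → y j + el i * v j)
      c : Carrier
      c = value (τ zero)
      roots : ∀ i → eval (subConst b c) (el (τ i)) ≈ 0#
      roots i = trans (eval-subConst b c (el (τ i))) (x≈y⇒x∙y⁻¹≈ε (trans (sym (on-line (el (τ i))))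
        (same-class (≡.trans (const (el (τ i))) (≡.sym (const (el (τ zero))))) (τ-same i zero))))
      regular : ∀ i j → i ≢ j → Regular (el (τ i) - el (τ j))
      regular i j i≢j a eq = *-cancelˡ-nonZero
        (i≢j ∘ τ-injective i j ∘ el-injective ∘ x∙y⁻¹≈ε⇒x≈y _ _) (trans eq (sym (zeroʳ _)))

-- Colourings of projective space: subspaces, sums, and the passage from affine space.

module ProjectiveColorings {q : ℕ} (F : FiniteField q) where
  open FiniteField F hiding (zero)
  open RingProperties ring
  open Solver commutativeSemiring using (solve; _:=_; _:+_; _:*_)
  open SetoidReasoning setoid
  open FieldElements F
  open AffineColorings F using (AffineColoring; zero?; isZero-split)

  1≉0 : ¬ 1# ≈ 0#
  1≉0 = 0≉1 ∘ sym

  -- The colour `κ` is not tied to a generator, so the generators can be exchanged while it stays.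
  MonoLine : ∀ {n k} → (Vect F n → Fin k) → Fin k → Vect F n → Vect F n → Set
  MonoLine c κ u v = ∀ a b → ¬ IsZero F (lin F a u b v) → c (lin F a u b v) ≡ κ

  cons : ∀ {n} → Carrier → Vect F n → Vect F (suc n)
  cons a x zero    = a
  cons a x (suc i) = x i

  cons-cong : ∀ {n a b} {x y : Vect F n} → a ≈ b → (∀ i → x i ≈ y i) → ∀ i → cons a x i ≈ cons b y i
  cons-cong a≈b x≈y zero    = a≈b
  cons-cong a≈b x≈y (suc i) = x≈y i

  0a+0b≈0 : ∀ {x y} → x ≈ 0# → y ≈ 0# → ∀ a b → a * x + b * y ≈ 0#
  0a+0b≈0 x≈0 y≈0 a b = trans (+-cong (trans (*-congˡ x≈0) (zeroʳ a)) (trans (*-congˡ y≈0) (zeroʳ b))) (+-identityˡ 0#)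

  -- The smaller space is the hyperplane of vectors with first coordinate zero, and its lines are
  -- lines of the larger one.
  restrict : ∀ {n k} → Colorable F (suc n) k → Colorable F n k
  restrict {n} (c , proper) = c ∘ cons 0# , record
    { respects-≈   = λ u v u≈v → respects-≈ _ _ (cons-cong refl u≈v)
    ; respects-pts = λ a v a≉0 v≉0 → ≡.trans
        (respects-≈ _ _ (λ { zero → sym (zeroʳ a) ; (suc i) → refl }))
        (respects-pts a (cons 0# v) a≉0 (λ v≈0 → v≉0 (v≈0 ∘ suc)))
    ; no-mono-line = λ u v indep mono → no-mono-line (cons 0# u) (cons 0# v)
        (λ a b z → indep a b (z ∘ suc))
        λ a b nz → ≡.trans (respects-≈ _ _ (λ { zero → 0a+0b≈0 refl refl a b ; (suc i) → refl }))
          (mono a b λ z → nz λ { zero → 0a+0b≈0 refl refl a b ; (suc i) → z i })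
    }
    where open ProperColoring proper

  restrict-≤ : ∀ {n n′ k} → n ℕ.≤ n′ → Colorable F n′ k → Colorable F n k
  restrict-≤ {n} n≤n′ = go (ℕ.≤⇒≤′ n≤n′)
    where
    go : ∀ {n′ k} → n ℕ.≤′ n′ → Colorable F n′ k → Colorable F n k
    go (ℕ.≤′-reflexive ≡.refl) col = col
    go (ℕ.≤′-step le)          col = go le (restrict col)

  module _ {n m k l} (left : Colorable F n k) (right : Colorable F m l) where
    private
      module L = ProperColoring (proj₂ left)
      module R = ProperColoring (proj₂ right)

      fst : Vect F (n ℕ.+ m) → Vect F n
      fst x = x ∘ (_↑ˡ m)
      snd : Vect F (n ℕ.+ m) → Vect F m
      snd x = x ∘ (n ↑ʳ_)

      choose : ∀ x → Dec (IsZero F (fst x)) → Fin (k ℕ.+ l)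
      choose x (yes _) = k ↑ʳ proj₁ right (snd x)
      choose x (no _)  = proj₁ left (fst x) ↑ˡ l

      color : Vect F (n ℕ.+ m) → Fin (k ℕ.+ l)
      color x = choose x (zero? (fst x))

      color-zero : ∀ x → IsZero F (fst x) → color x ≡ k ↑ʳ proj₁ right (snd x)
      color-zero x x≈0 with zero? (fst x)
      ... | yes _   = ≡.refl
      ... | no  x≉0 = contradiction x≈0 x≉0

      color-nonzero : ∀ x → ¬ IsZero F (fst x) → color x ≡ proj₁ left (fst x) ↑ˡ l
      color-nonzero x x≉0 with zero? (fst x)
      ... | yes x≈0 = contradiction x≈0 x≉0
      ... | no  _   = ≡.refl

      ↑ˡ≢↑ʳ : ∀ (i : Fin k) (j : Fin l) → i ↑ˡ l ≢ k ↑ʳ j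
      ↑ˡ≢↑ʳ i j eq with ≡.trans (≡.sym (Fin.splitAt-↑ˡ k i l)) (≡.trans (≡.cong (splitAt k) eq) (Fin.splitAt-↑ʳ k l j))
      ... | ()

      scale-zero : ∀ {n} a (x : Vect F n) → ¬ a ≈ 0# → IsZero F (scale F a x) → IsZero F x
      scale-zero a x a≉0 ax≈0 i = *-cancelˡ-nonZero a≉0 (trans (ax≈0 i) (sym (zeroʳ a)))

      respects : ∀ x y → (∀ i → fst x i ≈ 0# → fst y i ≈ 0#) → (∀ i → fst y i ≈ 0# → fst x i ≈ 0#) →
                 (¬ IsZero F (fst x) → proj₁ left (fst x) ≡ proj₁ left (fst y)) →
                 (IsZero F (fst x) → proj₁ right (snd x) ≡ proj₁ right (snd y)) → color x ≡ color y
      respects x y to from eqˡ eqʳ with zero? (fst x)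
      ... | yes x≈0 = ≡.trans (≡.cong (k ↑ʳ_) (eqʳ x≈0)) (≡.sym (color-zero y (λ i → to i (x≈0 i))))
      ... | no  x≉0 = ≡.trans (≡.cong (_↑ˡ l) (eqˡ x≉0)) (≡.sym (color-nonzero y (λ y≈0 → x≉0 (λ i → from i (y≈0 i)))))

      -- The two palettes are disjoint. A line with a left colour misses the subspace where `fst`
      -- vanishes, so `fst` maps it to a monochromatic line; a line with a right colour lies inside
      -- that subspace.
      no-mono-line : ∀ u v → LinIndep F u v → ¬ MonoLine color (color u) u v
      no-mono-line u v indep mono with zero? (fst u)
      ... | no u₁≉0 = L.no-mono-line (fst u) (fst v)
        (λ a b z → indep a b (decidable-stable (zero? (lin F a u b v)) λ nz → first≉0 a b nz z))
        λ a b nz → Fin.↑ˡ-injective l _ _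
          (≡.trans (≡.sym (color-nonzero (lin F a u b v) nz)) (mono a b (λ z → nz (z ∘ (_↑ˡ m)))))
        where
        first≉0 : ∀ a b → ¬ IsZero F (lin F a u b v) → ¬ IsZero F (fst (lin F a u b v))
        first≉0 a b nz z = ↑ˡ≢↑ʳ _ _ (≡.trans (≡.sym (mono a b nz)) (color-zero (lin F a u b v) z))
      ... | yes u₁≈0 = R.no-mono-line (snd u) (snd v)
        (λ a b z → indep a b (decidable-stable (zero? (lin F a u b v)) λ nz → nz (isZero-split n (first≈0 a b nz) z)))
        λ a b nz → let nz′ = λ z → nz (z ∘ (n ↑ʳ_)) in Fin.↑ʳ-injective k _ _
          (≡.trans (≡.sym (color-zero (lin F a u b v) (first≈0 a b nz′))) (mono a b nz′))
        where
        first≈0 : ∀ a b → ¬ IsZero F (lin F a u b v) → IsZero F (fst (lin F a u b v))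
        first≈0 a b nz = decidable-stable (zero? (fst (lin F a u b v))) λ nz₁ →
          ↑ˡ≢↑ʳ _ _ (≡.trans (≡.sym (color-nonzero (lin F a u b v) nz₁)) (mono a b nz))

    colorable-+ : Colorable F (n ℕ.+ m) (k ℕ.+ l)
    colorable-+ = color , record
      { respects-≈   = λ u v u≈v → respects u v
          (λ i → trans (sym (u≈v _))) (λ i → trans (u≈v _))
          (λ _ → L.respects-≈ _ _ (λ i → u≈v (i ↑ˡ m))) (λ _ → R.respects-≈ _ _ (λ i → u≈v (n ↑ʳ i)))
      ; respects-pts = λ a v a≉0 v≉0 → respects (scale F a v) v
          (λ i av≈0 → *-cancelˡ-nonZero a≉0 (trans av≈0 (sym (zeroʳ a))))
          (λ i v≈0 → trans (*-congˡ v≈0) (zeroʳ a))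
          (λ av₁≉0 → L.respects-pts a (fst v) a≉0 λ v₁≈0 → av₁≉0 λ i → trans (*-congˡ (v₁≈0 i)) (zeroʳ a))
          (λ av₁≈0 → R.respects-pts a (snd v) a≉0 λ v₂≈0 → v≉0 (isZero-split n (scale-zero a (fst v) a≉0 av₁≈0) v₂≈0))
      ; no-mono-line = no-mono-line
      }

  colorable-* : ∀ {n k} t → Colorable F n k → Colorable F (suc t ℕ.* n) (suc t ℕ.* k)
  colorable-* {n} {k} zero    col = ≡.subst₂ (Colorable F) (≡.sym (ℕ.+-identityʳ n)) (≡.sym (ℕ.+-identityʳ k)) col
  colorable-* (suc t) col = colorable-+ col (colorable-* t col)

  private
    tail : ∀ {M k} → AffineColoring (suc M) k → AffineColoring M k
    tail e = record
      { color       = color ∘ cons 0#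
      ; color-cong  = λ x≈y → color-cong (cons-cong refl x≈y)
      ; nonconstant = λ y v v≉0 const → nonconstant (cons 0# y) (cons 0# v) (λ z → v≉0 (z ∘ suc)) λ a →
          ≡.trans (color-cong λ { zero → trans (+-congˡ (zeroʳ a)) (+-identityˡ 0#) ; (suc i) → refl }) (const a)
      }
      where open AffineColoring e

  -- Normalising the first nonzero coordinate to 1, all points of a line but one lie on an affine line.
  affine⇒colorable : ∀ {M k} → AffineColoring M k → Colorable F M k
  affine⇒colorable {zero} e = (λ _ → AffineColoring.color e (λ ())) , record
    { respects-≈   = λ _ _ _ → ≡.refl
    ; respects-pts = λ _ _ _ _ → ≡.refl
    ; no-mono-line = λ _ _ indep _ → 1≉0 (proj₁ (indep 1# 1# λ ()))
    }
  affine⇒colorable {suc M} {k} e = c , record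
    { respects-≈   = respects-≈
    ; respects-pts = respects-pts
    ; no-mono-line = no-mono-line
    }
    where
    open AffineColoring e
    module Tail = ProperColoring (proj₂ (affine⇒colorable (tail e)))

    choose : ∀ x → Dec (x zero ≈ 0#) → Fin k
    -- The hyperplane at infinity is coloured recursively with the same palette, since a line
    -- outside it has only one point in common with it.
    choose x (yes _)   = proj₁ (affine⇒colorable (tail e)) (x ∘ suc)
    choose x (no x₀≉0) = color (scale F (proj₁ (inverse (x zero) x₀≉0)) x)

    c : Vect F (suc M) → Fin k
    c x = choose x (x zero ≟ 0#)

    c-zero : ∀ x → x zero ≈ 0# → c x ≡ proj₁ (affine⇒colorable (tail e)) (x ∘ suc)
    c-zero x x₀≈0 with x zero ≟ 0#
    ... | yes _    = ≡.refl
    ... | no  x₀≉0 = contradiction x₀≈0 x₀≉0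

    -- Inverses are unique up to `≈`, so any of them computes the colour; independence of the
    -- representative is derived from this.
    c-nonzero : ∀ x w → x zero * w ≈ 1# → c x ≡ color (scale F w x)
    c-nonzero x w x₀w≈1 with x zero ≟ 0#
    ... | yes x₀≈0 = contradiction (trans (sym x₀w≈1) (trans (*-congʳ x₀≈0) (zeroˡ w))) 1≉0
    ... | no  x₀≉0 = color-cong λ i → *-congʳ
      (*-cancelˡ-nonZero x₀≉0 (trans (proj₂ (inverse (x zero) x₀≉0)) (sym x₀w≈1)))

    respects-≈ : ∀ u v → (∀ i → u i ≈ v i) → c u ≡ c v
    respects-≈ u v u≈v with v zero ≟ 0#
    ... | yes v₀≈0 = ≡.trans (c-zero u (trans (u≈v zero) v₀≈0)) (Tail.respects-≈ _ _ (u≈v ∘ suc))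
    ... | no  v₀≉0 with inverse (v zero) v₀≉0
    ...   | w , v₀w≈1 = ≡.trans (c-nonzero u w (trans (*-congʳ (u≈v zero)) v₀w≈1)) (color-cong λ i → *-congˡ (u≈v i))

    respects-pts : ∀ a v → ¬ a ≈ 0# → ¬ IsZero F v → c (scale F a v) ≡ c v
    respects-pts a v a≉0 v≉0 with v zero ≟ 0#
    ... | yes v₀≈0 = ≡.trans (c-zero (scale F a v) (trans (*-congˡ v₀≈0) (zeroʳ a)))
      (Tail.respects-pts a (v ∘ suc) a≉0 λ z → v≉0 λ { zero → v₀≈0 ; (suc i) → z i })
    ... | no  v₀≉0 with inverse (v zero) v₀≉0 | inverse a a≉0
    ...   | w , v₀w≈1 | a⁻¹ , aa⁻¹≈1 = ≡.trans
      (c-nonzero (scale F a v) (a⁻¹ * w) (trans (cancel (v zero) w) v₀w≈1))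
      (color-cong λ i → trans (solve 4 (λ x w a b → (b :* w) :* (a :* x) := (a :* x) :* (b :* w)) refl (v i) w a a⁻¹)
                              (trans (cancel (v i) w) (*-comm _ _)))
      where
      cancel : ∀ x w → (a * x) * (a⁻¹ * w) ≈ x * w
      cancel x w = begin
        (a * x) * (a⁻¹ * w)    ≈⟨ solve 4 (λ a x b w → (a :* x) :* (b :* w) := (a :* b) :* (x :* w)) refl a x a⁻¹ w ⟩
        (a * a⁻¹) * (x * w)    ≈⟨ *-congʳ aa⁻¹≈1 ⟩
        1# * (x * w)           ≈⟨ *-identityˡ _ ⟩
        x * w                  ∎

    no-mono-line₀ : ∀ κ u v → ¬ u zero ≈ 0# → LinIndep F u v → ¬ MonoLine c κ u v
    no-mono-line₀ κ u v u₀≉0 indep mono with inverse (u zero) u₀≉0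
    ... | w , u₀w≈1 = nonconstant y v′ v′≉0 λ a → ≡.trans (color-point a) (≡.sym color-y)
      where
      v₀ = v zero
      -- `y` is the generator `u` scaled to first coordinate 1, and `v′` is the point at infinity of
      -- the line. The vectors y + a v′ are then normalised points of the line.
      y v′ : Vect F (suc M)
      y i  = w * u i
      v′ i = v i - v₀ * y i

      y₀≈1 : y zero ≈ 1#
      y₀≈1 = trans (*-comm w _) u₀w≈1

      combine : ∀ a i → y i + a * v′ i ≈ lin F (w + a * - (v₀ * w)) u a v i
      combine a i = begin
        y i + a * (v i - v₀ * (w * u i))
          ≈⟨ +-congˡ (*-congˡ (+-congˡ (trans (-‿cong (sym (*-assoc v₀ w (u i)))) (-‿distribˡ-* (v₀ * w) (u i))))) ⟩
        w * u i + a * (v i + - (v₀ * w) * u i)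
          ≈⟨ solve 5 (λ w x a y m → w :* x :+ a :* (y :+ m :* x) := (w :+ a :* m) :* x :+ a :* y) refl w (u i) a (v i) (- (v₀ * w)) ⟩
        (w + a * - (v₀ * w)) * u i + a * v i ∎

      v′₀≈0 : v′ zero ≈ 0#
      v′₀≈0 = trans (+-congˡ (-‿cong (trans (*-congˡ y₀≈1) (*-identityʳ v₀)))) (-‿inverseʳ v₀)

      point₀≈1 : ∀ a → y zero + a * v′ zero ≈ 1#
      point₀≈1 a = trans (+-cong y₀≈1 (trans (*-congˡ v′₀≈0) (zeroʳ a))) (+-identityʳ 1#)

      v′≉0 : ¬ IsZero F v′
      v′≉0 z = 1≉0 (proj₂ (indep (- (v₀ * w)) 1# λ i → begin
        - (v₀ * w) * u i + 1# * v i      ≈⟨ +-cong (trans (sym (-‿distribˡ-* (v₀ * w) (u i))) (-‿cong (*-assoc v₀ w (u i)))) (*-identityˡ _) ⟩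
        - (v₀ * y i) + v i               ≈⟨ +-comm _ _ ⟩
        v′ i                             ≈⟨ z i ⟩
        0#                               ∎))

      mono-≈ : ∀ x a b → (∀ i → x i ≈ lin F a u b v i) → x zero ≈ 1# → c x ≡ κ
      mono-≈ x a b x≈ x₀≈1 = ≡.trans (respects-≈ x (lin F a u b v) x≈)
        (mono a b λ z → 1≉0 (trans (sym x₀≈1) (trans (x≈ zero) (z zero))))

      normalised : ∀ x → x zero ≈ 1# → color x ≡ c x
      normalised x x₀≈1 = ≡.sym (≡.trans (c-nonzero x 1# (trans (*-identityʳ _) x₀≈1)) (color-cong λ i → *-identityˡ (x i)))

      color-point : ∀ a → color (λ i → y i + a * v′ i) ≡ κ
      color-point a = ≡.trans (normalised (λ i → y i + a * v′ i) (point₀≈1 a))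
        (mono-≈ (λ i → y i + a * v′ i) (w + a * - (v₀ * w)) a (combine a) (point₀≈1 a))

      color-y : color y ≡ κ
      color-y = ≡.trans (normalised y y₀≈1)
        (mono-≈ y w 0# (λ i → sym (trans (+-congˡ (zeroˡ (v i))) (+-identityʳ _))) y₀≈1)

    no-mono-line : ∀ u v → LinIndep F u v → ¬ MonoLine c (c u) u v
    no-mono-line u v indep mono = cases (u zero ≟ 0#) (v zero ≟ 0#)
      where
      swap : ∀ a b i → lin F a v b u i ≈ lin F b u a v i
      swap a b i = +-comm _ _

      cases : Dec (u zero ≈ 0#) → ¬ Dec (v zero ≈ 0#)
      cases (no u₀≉0)  _          = no-mono-line₀ (c u) u v u₀≉0 indep mono
      cases (yes u₀≈0) (no v₀≉0)  = no-mono-line₀ (c u) v u v₀≉0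
        (λ a b z → let p = indep b a (λ i → trans (sym (swap a b i)) (z i)) in proj₂ p , proj₁ p)
        (λ a b nz → ≡.trans (respects-≈ _ _ (swap a b)) (mono b a λ z → nz λ i → trans (swap a b i) (z i)))
      cases (yes u₀≈0) (yes v₀≈0) = Tail.no-mono-line (u ∘ suc) (v ∘ suc)
        (λ a b z → indep a b λ { zero → lin₀≈0 a b ; (suc i) → z i })
        (λ a b nz → ≡.trans (≡.sym (c-zero (lin F a u b v) (lin₀≈0 a b)))
          (≡.trans (mono a b (λ z → nz (z ∘ suc))) (c-zero u u₀≈0)))
        where
        lin₀≈0 : ∀ a b → lin F a u b v zero ≈ 0#
        lin₀≈0 = 0a+0b≈0 u₀≈0 v₀≈0

-- The two numerical bounds.

module Bounds where
  open import Data.Nat using (ℕ; zero; suc; _+_; _*_; _∸_; _^_; _≤_; _<_; z≤n; s≤s; NonZero)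
  open import Data.Nat.Properties
  open import Data.Nat.DivMod using (_/_; m/n*n≤m; m<n⇒m/n≡0; m≡m%n+[m/n]*n; m%n<n)
  open import Data.Nat.Solver using (module +-*-Solver)
  open import Relation.Binary.PropositionalEquality using (_≡_; refl; sym; trans; cong; subst)
  open +-*-Solver using (solve; _:=_; _:+_; _:*_; con)
  open AffineColorings using (affinePolynomial; affineColoring)
  open ProjectiveColorings using (affine⇒colorable; colorable-*; restrict-≤)
  open Pigeonhole using (triangular)

  2*triangular : ∀ D → 2 * triangular D ≡ D * suc D
  2*triangular zero    = refl
  2*triangular (suc D) = trans (*-distribˡ-+ 2 (suc D) (triangular D)) (trans (cong (2 * suc D +_) (2*triangular D))
    (solve 1 (λ D → con 2 :* (con 1 :+ D) :+ D :* (con 1 :+ D) := (con 1 :+ D) :* (con 2 :+ D)) refl D))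

  triangular-bracket : ∀ n → Σ ℕ λ j → triangular j < suc n × suc n ≤ triangular (suc j)
  triangular-bracket zero    = 0 , s≤s z≤n , s≤s z≤n
  triangular-bracket (suc n) with triangular-bracket n
  ... | j , lo , hi with suc (suc n) ≤? triangular (suc j)
  ...   | yes hi′ = j , m<n⇒m<1+n lo , hi′
  ...   | no  n≰  = suc j , ≰⇒> n≰ , ≤-trans (s≤s hi) (s≤s (m≤n+m _ (suc j)))

  module _ {q : ℕ} (F : FiniteField q) where

    colorable-triangular : ∀ D k .{{_ : NonZero k}} → D < q → suc ((q ∸ 1) / k) * D < q → Colorable F (triangular D) k
    colorable-triangular D k D<q small = affine⇒colorable F (affineColoring F (affinePolynomial F D D<q) k small)

    -- Blocks of q (q - 1) / 2 coordinates take q colours each, so a full block costs 2 / (q - 1)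
    -- colours per coordinate, and rounding up costs less than one more block. The inequality is
    -- multiplied by q - 1 to stay in ℕ.
    linear-bound : ∀ n → 2 ≤ n → Σ ℕ (λ k → Colorable F n k × k * (q ∸ 1) < 2 * n + q * (q ∸ 1))
    linear-bound (suc n) _ = go q (FieldElements.1<q F) colorable-triangular
      where
      go : ∀ q → 1 < q →
           (∀ D k .{{_ : NonZero k}} → D < q → suc ((q ∸ 1) / k) * D < q → Colorable F (triangular D) k) →
           Σ ℕ (λ k → Colorable F (suc n) k × k * (q ∸ 1) < 2 * suc n + q * (q ∸ 1))
      go (suc zero) (s≤s ())
      go (suc D@(suc _)) _ colorable = suc t * suc D , restrict-≤ F n<tM (colorable-* F t block) , bound
        where
        M = triangular D
        -- There are `suc n` coordinates, so `suc t` is the quotient of `suc n` by `M` rounded up.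
        t = n / M
        block : Colorable F M (suc D)
        -- With as many colours as field elements the classes are singletons: `D / suc D` is zero.
        block = colorable D (suc D) (n<1+n D)
          (subst (λ s → suc s * D < suc D) (sym (m<n⇒m/n≡0 (n<1+n D))) (s≤s (≤-reflexive (*-identityˡ D))))
        n<tM : suc n ≤ suc t * M
        n<tM = subst (_< suc t * M) (sym (m≡m%n+[m/n]*n n M)) (+-monoˡ-< (t * M) (m%n<n n M))
        bound : suc t * suc D * D < 2 * suc n + suc D * D
        bound = begin-strict
          suc t * suc D * D            ≡⟨ solve 2 (λ t D → (con 1 :+ t) :* (con 1 :+ D) :* D
                                            := t :* (D :* (con 1 :+ D)) :+ (con 1 :+ D) :* D) refl t D ⟩
          t * (D * suc D) + suc D * D  ≡⟨ cong (λ x → t * x + suc D * D) (2*triangular D) ⟨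
          t * (2 * M) + suc D * D      ≡⟨ cong (_+ suc D * D) (solve 2 (λ t M → t :* (con 2 :* M) := con 2 :* (t :* M)) refl t M) ⟩
          2 * (t * M) + suc D * D      ≤⟨ +-monoˡ-≤ (suc D * D) (*-monoʳ-≤ 2 (m/n*n≤m n M)) ⟩
          2 * n + suc D * D            <⟨ +-monoˡ-< (suc D * D) (*-monoʳ-< 2 (n<1+n n)) ⟩
          2 * suc n + suc D * D        ∎
          where open ≤-Reasoning

    -- `D` is the least number whose triangular number reaches the number of coordinates. The
    -- hypothesis is the bound by (q/2)(q/2 - 1)/2 multiplied by 8, and the conclusion is k - 4 ≤
    -- √(8n) squared, with k < 4 covered by truncation.
    sqrt-bound : ∀ n → 2 ≤ n → 8 * n ≤ q * (q ∸ 2) → Σ ℕ (λ k → Colorable F n k × (k ∸ 4) ^ 2 ≤ 8 * n)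
    sqrt-bound (suc n) _ 8n≤ with triangular-bracket n
    ... | j , lo , hi = k , restrict-≤ F hi (colorable-triangular D k D<q small) , square-bound
      where
      open ≤-Reasoning
      D k : ℕ
      D = suc j
      -- With `2 * D` classes, `D` times the class size is at most D + (q - 1) / 2, which is below q
      -- once 2 D ≤ q.
      k = 2 * D

      2≤4 : 2 ≤ 4
      2≤4 = s≤s (s≤s z≤n)

      4j[j+1]<8n : 4 * (j * suc j) < 8 * suc n
      4j[j+1]<8n = begin-strict
        4 * (j * suc j)          ≡⟨ cong (4 *_) (2*triangular j) ⟨
        4 * (2 * triangular j)   ≡⟨ *-assoc 4 2 (triangular j) ⟨
        8 * triangular j         <⟨ *-monoʳ-< 8 lo ⟩
        8 * suc n                ∎

      -- Otherwise q ≤ 2 j + 1, and q (q - 2) ≤ 4 j (j + 1) falls short of eight times the number of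
      -- coordinates, against the hypothesis.
      k≤q : k ≤ q
      k≤q with k ≤? q
      ... | yes k≤q = k≤q
      ... | no  k≰q = contradiction 8n≤ (<⇒≱ (begin-strict
        q * (q ∸ 2)                    ≤⟨ *-mono-≤ q≤1+2j (≤-trans (∸-monoˡ-≤ 2 q≤1+2j) (m∸n≤m (2 * j) 1)) ⟩
        suc (2 * j) * (2 * j)          ≡⟨ solve 1 (λ j → (con 1 :+ con 2 :* j) :* (con 2 :* j) := con 4 :* (j :* j) :+ con 2 :* j) refl j ⟩
        4 * (j * j) + 2 * j            ≤⟨ +-monoʳ-≤ (4 * (j * j)) (*-monoˡ-≤ j 2≤4) ⟩
        4 * (j * j) + 4 * j            ≡⟨ solve 1 (λ j → con 4 :* (j :* j) :+ con 4 :* j := con 4 :* (j :* (con 1 :+ j))) refl j ⟩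
        4 * (j * suc j)                <⟨ 4j[j+1]<8n ⟩
        8 * suc n                      ∎))
        where
        q≤1+2j : q ≤ suc (2 * j)
        q≤1+2j = ≤-pred (≤-trans (≰⇒> k≰q) (≤-reflexive (*-suc 2 j)))

      D<q : D < q
      D<q = <-≤-trans (m<m+n D (s≤s z≤n)) k≤q

      small : suc ((q ∸ 1) / k) * D < q
      small = *-cancelˡ-< 2 _ _ (begin-strict
        2 * (suc ((q ∸ 1) / k) * D)    ≡⟨ solve 2 (λ s D → con 2 :* ((con 1 :+ s) :* D) := con 2 :* D :+ s :* (con 2 :* D)) refl ((q ∸ 1) / k) D ⟩
        k + (q ∸ 1) / k * k            ≤⟨ +-mono-≤ k≤q (m/n*n≤m (q ∸ 1) k) ⟩
        q + (q ∸ 1)                    <⟨ +-monoʳ-< q (∸-monoʳ-< {q} (s≤s z≤n) (≤-trans (s≤s z≤n) D<q)) ⟩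
        q + q                          ≡⟨ cong (q +_) (+-identityʳ q) ⟨
        2 * q                          ∎)

      square-bound : (k ∸ 4) ^ 2 ≤ 8 * suc n
      square-bound = begin
        -- `k ∸ 4` is at most `k ∸ 2`, which is `2 * j`, and 4 j² ≤ 4 j (j + 1).
        (k ∸ 4) ^ 2                    ≤⟨ ^-monoˡ-≤ 2 (≤-trans (∸-monoʳ-≤ k 2≤4) (≤-reflexive (cong (_∸ 2) (*-suc 2 j)))) ⟩
        (2 * j) ^ 2                    ≡⟨ solve 1 (λ j → (con 2 :* j) :* ((con 2 :* j) :* con 1) := con 4 :* (j :* j)) refl j ⟩
        4 * (j * j)                    ≤⟨ *-monoʳ-≤ 4 (*-monoʳ-≤ j (n≤1+n j)) ⟩
        4 * (j * suc j)                <⟨ 4j[j+1]<8n ⟩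
        8 * suc n                      ∎

open import Data.Nat using (ℕ; _+_; _*_; _∸_; _^_; _≤_; _<_)
open Bounds using (linear-bound; sqrt-bound)

theorem1p4 : (q : ℕ) (F : FiniteField q) (n : ℕ) → 2 ≤ n →
    Σ ℕ (λ k → Colorable F n k × k * (q ∸ 1) < 2 * n + q * (q ∸ 1))
    × (8 * n ≤ q * (q ∸ 2) → Σ ℕ (λ k → Colorable F n k × (k ∸ 4) ^ 2 ≤ 8 * n))
theorem1p4 q F n 2≤n = linear-bound F n 2≤n , sqrt-bound F n 2≤n
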